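{- Every family $(f_n)\in\mathsf{VP}$ can be computed by a family of stack branching programs of size polynomial in $n$.
   Context: $\mathsf{VP}$ is the class of polynomial families over a field $\mathbb{F}$ of degree polynomially bounded in $n$ computed by arithmetic circuits (DAGs with input gates labeled by constants or variables and fanin-2 $+$/$\times$ gates; size = number of gates) of size polynomial in $n$. Stack operations over a finite symbol set $S$: $\mathrm{push}(s)$, $\mathrm{pop}(s)$ ($s\in S$), $\mathrm{nop}$. Realizable sequences: the empty sequence is realizable; if $P$ is realizable then $\mathrm{push}(s)P\,\mathrm{pop}(s)$, $\mathrm{nop}\,P$ and $P\,\mathrm{nop}$ are realizable; if $P,Q$ are realizable so is $PQ$. A stack branching program is a DAG with distinguished vertices $s,t$, edge weights $w:E\to\mathbb{F}\cup\{X_1,X_2,\dots\}$ and edge labels $\sigma$ by stack operations; it computes the sum of weights (products of edge weights) of all $s$-$t$-paths whose operation sequence is realizable. Size = number of vertices. -}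

module Defs where

open import Level using (Level)
import Level
open import Algebra.Bundles using (CommutativeRing)
open import Data.Nat as ℕ using (ℕ; zero; _≤_)
  renaming (suc to sucℕ; _+_ to _+ℕ_; _*_ to _*ℕ_; _^_ to _^ℕ_)
open import Data.Fin using (Fin; toℕ; inject₁; fromℕ)
import Data.Fin
import Data.List
import Data.List.Membership.Propositional
open import Data.List using (List; []; _∷_; map; concatMap; filter; length)
open import Data.Product using (Σ; Σ-syntax; ∃; ∃-syntax; _×_; _,_)
open import Relation.Nullary using (¬_; yes; no)
open import Relation.Binary.PropositionalEquality using (_≡_)

record Field (c ℓ : Level) : Set (Level.suc (c Level.⊔ ℓ)) where
  field
    commutativeRing : CommutativeRing c ℓ
  open CommutativeRing commutativeRing public
  field
    0≉1     : ¬ (0# ≈ 1#)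
    inverse : ∀ x → ¬ (x ≈ 0#) → Σ[ y ∈ Carrier ] (x * y ≈ 1#)

-- Polynomially bounded functions ℕ → ℕ

bound : ℕ → ℕ → ℕ
bound c n = c *ℕ (n ^ℕ c) +ℕ c

module _ {c ℓ : Level} (F : Field c ℓ) where
  open Field F using (Carrier; _≈_; _+_; _*_; -_; 0#; 1#)

  -- Polynomials over F in the variables X₁, X₂, … (variable X_{i+1} is
  -- 'var i').  F[X] is presented as formal expressions modulo the least
  -- congruence making it a commutative F-algebra (free commutative
  -- F-algebra on the variables = the polynomial ring).

  infixl 6 _⊕_
  infixl 7 _⊗_

  data Poly : Set c where
    con : Carrier → Poly
    var : ℕ → Poly
    _⊕_ : Poly → Poly → Poly
    _⊗_ : Poly → Poly → Poly

  infix 4 _≃_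
  data _≃_ : Poly → Poly → Set (c Level.⊔ ℓ) where
    ≃-refl  : ∀ {p} → p ≃ p
    ≃-sym   : ∀ {p q} → p ≃ q → q ≃ p
    ≃-trans : ∀ {p q r} → p ≃ q → q ≃ r → p ≃ r
    ⊕-cong  : ∀ {p p′ q q′} → p ≃ p′ → q ≃ q′ → p ⊕ q ≃ p′ ⊕ q′
    ⊗-cong  : ∀ {p p′ q q′} → p ≃ p′ → q ≃ q′ → p ⊗ q ≃ p′ ⊗ q′
    con-cong : ∀ {a b} → a ≈ b → con a ≃ con b
    con-+   : ∀ a b → con (a + b) ≃ con a ⊕ con b
    con-*   : ∀ a b → con (a * b) ≃ con a ⊗ con b
    ⊕-assoc : ∀ p q r → (p ⊕ q) ⊕ r ≃ p ⊕ (q ⊕ r)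
    ⊕-comm  : ∀ p q → p ⊕ q ≃ q ⊕ p
    ⊕-idʳ   : ∀ p → p ⊕ con 0# ≃ p
    ⊕-invʳ  : ∀ p → p ⊕ (con (- 1#) ⊗ p) ≃ con 0#
    ⊗-assoc : ∀ p q r → (p ⊗ q) ⊗ r ≃ p ⊗ (q ⊗ r)
    ⊗-comm  : ∀ p q → p ⊗ q ≃ q ⊗ p
    ⊗-idʳ   : ∀ p → p ⊗ con 1# ≃ p
    distribʳ : ∀ p q r → (p ⊕ q) ⊗ r ≃ (p ⊗ r) ⊕ (q ⊗ r)

  fdeg : Poly → ℕ
  fdeg (con _) = 0
  fdeg (var _) = 1
  fdeg (p ⊕ q) = fdeg p ℕ.⊔ fdeg q
  fdeg (p ⊗ q) = fdeg p +ℕ fdeg q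

  -- the polynomial p has degree ≤ d (some representative of p has
  -- formal degree ≤ d; e.g. its sum-of-monomials form)
  DegreeAtMost : Poly → ℕ → Set (c Level.⊔ ℓ)
  DegreeAtMost p d = Σ[ e ∈ Poly ] (e ≃ p × fdeg e ≤ d)

  -- Arithmetic circuits: gates listed in a topological order; each
  -- +/× gate has two (not necessarily distinct) predecessors among the
  -- earlier gates.  Size = number of gates; the output is the last gate.

  data Gate (k : ℕ) : Set c where
    cgate : Carrier → Gate k
    xgate : ℕ → Gate k
    +gate : Fin k → Fin k → Gate k
    ×gate : Fin k → Fin k → Gate k

  data Circuit : ℕ → Set c where
    []  : Circuit 0
    _▷_ : ∀ {k} → Circuit k → Gate k → Circuit (sucℕ k)

  gateVal : ∀ {k} → Circuit k → Fin k → Poly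
  gateVal (C ▷ g) Fin.zero = gateOut C g
    where
    gateOut : ∀ {k} → Circuit k → Gate k → Poly
    gateOut C (cgate a) = con a
    gateOut C (xgate i) = var i
    gateOut C (+gate i j) = gateVal C i ⊕ gateVal C j
    gateOut C (×gate i j) = gateVal C i ⊗ gateVal C j
  gateVal (C ▷ g) (Fin.suc i) = gateVal C i

  -- NB: index 'Fin.zero' of 'C ▷ g' is the newest (= output) gate.
  CircuitComputes : ∀ {k} → Circuit (sucℕ k) → Poly → Set (c Level.⊔ ℓ)
  CircuitComputes C f = gateVal C Fin.zero ≃ f

  InVP : (ℕ → Poly) → Set (c Level.⊔ ℓ)
  InVP f = Σ[ b ∈ ℕ ] (∀ n →
             DegreeAtMost (f n) (bound b n)
           × Σ[ s ∈ ℕ ] (sucℕ s ≤ bound b n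
           × Σ[ C ∈ Circuit (sucℕ s) ] CircuitComputes C (f n)))

  data StackOp (k : ℕ) : Set where
    push : Fin k → StackOp k
    pop  : Fin k → StackOp k
    nop  : StackOp k

  data Realizable {k : ℕ} : List (StackOp k) → Set where
    empty   : Realizable []
    wrap    : ∀ s {P} → Realizable P → Realizable (push s ∷ P Data.List.++ (pop s ∷ []))
    nopˡ    : ∀ {P} → Realizable P → Realizable (nop ∷ P)
    nopʳ    : ∀ {P} → Realizable P → Realizable (P Data.List.++ (nop ∷ []))
    concat  : ∀ {P Q} → Realizable P → Realizable Q → Realizable (P Data.List.++ Q)

  data Weight : Set c where
    wconst : Carrier → Weight
    wvar   : ℕ → Weight

  record Edge (m k : ℕ) : Set c where
    constructor edge
    field
      from   : Fin m
      to     : Fin m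
      weight : Weight
      op     : StackOp k

  record SBP : Set c where
    field
      m k    : ℕ
      edges  : List (Edge m k)
      source : Fin m
      sink   : Fin m

  module _ (B : SBP) where
    open SBP B
    open Edge

    data Walk : Fin m → Fin m → List (Edge m k) → Set c where
      here : ∀ {u} → Walk u u []
      step : ∀ {u v es} (e : Edge m k) →
             e Data.List.Membership.Propositional.∈ edges →
             from e ≡ u → Walk (to e) v es → Walk u v (e ∷ es)

    Acyclic : Set c
    Acyclic = ∀ {v es} → Walk v v es → es ≡ []

    walksToSink : ℕ → Fin m → List (List (Edge m k))
    walksToSink fuel u = base (u Data.Fin.≟ sink) Data.List.++ more fuel
      where
      base : _ → List (List (Edge m k))
      base (yes _) = [] ∷ []
      base (no _)  = []
      more : ℕ → List (List (Edge m k))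
      more zero = []
      more (sucℕ f) =
        concatMap (λ e → map (e ∷_) (walksToSink f (to e)))
                  (filter (λ e → from e Data.Fin.≟ u) edges)

    -- since B is acyclic, walks have < m edges, so this lists all s-t paths
    paths : List (List (Edge m k))
    paths = walksToSink m source

    wPoly : Weight → Poly
    wPoly (wconst a) = con a
    wPoly (wvar i)   = var i

    pathWeight : List (Edge m k) → Poly
    pathWeight []       = con 1#
    pathWeight (e ∷ es) = wPoly (weight e) ⊗ pathWeight es

    data SumRealizable : List (List (Edge m k)) → Poly → Set c where
      sum-nil  : SumRealizable [] (con 0#)
      sum-yes  : ∀ {p ps r} → Realizable (map op p) →
                 SumRealizable ps r → SumRealizable (p ∷ ps) (pathWeight p ⊕ r)
      sum-no   : ∀ {p ps r} → ¬ Realizable (map op p) →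
                 SumRealizable ps r → SumRealizable (p ∷ ps) r

    SBPComputes : Poly → Set (c Level.⊔ ℓ)
    SBPComputes f = Σ[ r ∈ Poly ] (SumRealizable paths r × r ≃ f)

  sbpSize : SBP → ℕ
  sbpSize B = SBP.m B

-- For a circuit C and a degree bound D, the vertex  node g k c  computes
-- component k+1 of gate g after c degrees have been produced.  A sum gate
-- branches to its inputs; for a product i × j the component is the
-- convolution Σₐ (component a of i)(component k+1-a of j), so the walk
-- descends into i and pushes the task "component k+1-a of j", popped later
-- at a return vertex; a variable produces one degree.  Walks reach the sink
-- only with exactly D degrees, so the program computes the truncation of the
-- output to degree D, which is f n.
module Submission where

open import Level using (Level; _⊔_)
open import Function using (_∘_)
open import Data.Empty using (⊥-elim)
open import Data.Nat as ℕ using (ℕ; zero; suc; _+_; _*_; _∸_; _^_; _≤_; _<_; z≤n; s≤s; _<?_)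
import Data.Nat.Properties as ℕₚ
open import Data.Nat.Tactic.RingSolver using (solve-∀)
open import Data.Fin as Fin using (Fin; toℕ; fromℕ<; combine; remQuot; splitAt; _↑ˡ_; _↑ʳ_)
import Data.Fin.Properties as Finₚ
open import Data.List as List using (List; []; _∷_; _++_; map; concatMap; filter; foldr; tabulate)
import Data.List.Properties as Listₚ
open import Data.List.Relation.Unary.All as All using (All; []; _∷_)
import Data.List.Relation.Unary.All.Properties as Allₚ
open import Data.Maybe using (Maybe; just; nothing)
open import Data.Product using (Σ-syntax; _×_; _,_; proj₁; proj₂; uncurry)
open import Data.Sum using (_⊎_; inj₁; inj₂)
open import Relation.Binary.Bundles using (Setoid)
open import Relation.Binary.PropositionalEquality as ≡ using (_≡_; _≢_; refl)
import Relation.Binary.Reasoning.Setoid as SetoidReasoning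
open import Relation.Nullary using (¬_; Dec; yes; no)
open import Relation.Unary using (Decidable)

open import Defs

-- If a + b < k then any split k = j + (k - j) has a < j or b < k - j
-- (components of a product vanish above the sum of the degrees).
degree-split : ∀ {a b k} j → a + b < k → a < j ⊎ b < k ∸ j
degree-split {a} {b} j a+b<k with a <? j
... | yes a<j = inj₁ a<j
... | no  a≮j = inj₂ (ℕₚ.m+n≤o⇒m≤o∸n (suc b) (begin-strict
      b + j  ≤⟨ ℕₚ.+-monoʳ-≤ b (ℕₚ.≮⇒≥ a≮j) ⟩
      b + a  ≡⟨ ℕₚ.+-comm b a ⟩
      a + b  <⟨ a+b<k ⟩
      _      ∎))
  where open ℕₚ.≤-Reasoning

module PolyAlgebra {c ℓ : Level} (F : Field c ℓ) where
  open Field F using (Carrier; -_; 0#; 1#; +-identityʳ)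
    renaming (_+_ to _+ꟳ_; _*_ to _*ꟳ_)

  infix 4 _≋_
  _≋_ : Poly F → Poly F → Set (c ⊔ ℓ)
  _≋_ = _≃_ F

  ≋-setoid : Setoid c (c ⊔ ℓ)
  ≋-setoid = record
    { Carrier = Poly F ; _≈_ = _≋_
    ; isEquivalence = record { refl = ≃-refl ; sym = ≃-sym ; trans = ≃-trans } }

  module ≋-Reasoning = SetoidReasoning ≋-setoid
  open ≋-Reasoning

  0P 1P : Poly F
  0P = con 0#
  1P = con 1#

  ≡⇒≋ : ∀ {p q} → p ≡ q → p ≋ q
  ≡⇒≋ refl = ≃-refl

  ⊕-congˡ : ∀ r {p q} → p ≋ q → r ⊕ p ≋ r ⊕ q
  ⊕-congˡ r e = ⊕-cong ≃-refl e

  ⊕-congʳ : ∀ r {p q} → p ≋ q → p ⊕ r ≋ q ⊕ r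
  ⊕-congʳ r e = ⊕-cong e ≃-refl

  ⊗-congˡ : ∀ r {p q} → p ≋ q → r ⊗ p ≋ r ⊗ q
  ⊗-congˡ r e = ⊗-cong ≃-refl e

  ⊗-congʳ : ∀ r {p q} → p ≋ q → p ⊗ r ≋ q ⊗ r
  ⊗-congʳ r e = ⊗-cong e ≃-refl

  ⊕-idˡ : ∀ p → 0P ⊕ p ≋ p
  ⊕-idˡ p = ≃-trans (⊕-comm _ _) (⊕-idʳ p)

  ⊗-idˡ : ∀ p → 1P ⊗ p ≋ p
  ⊗-idˡ p = ≃-trans (⊗-comm _ _) (⊗-idʳ p)

  distribˡ : ∀ p q r → p ⊗ (q ⊕ r) ≋ (p ⊗ q) ⊕ (p ⊗ r)
  distribˡ p q r = begin
    p ⊗ (q ⊕ r)         ≈⟨ ⊗-comm _ _ ⟩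
    (q ⊕ r) ⊗ p         ≈⟨ distribʳ q r p ⟩
    (q ⊗ p) ⊕ (r ⊗ p)   ≈⟨ ⊕-cong (⊗-comm _ _) (⊗-comm _ _) ⟩
    (p ⊗ q) ⊕ (p ⊗ r)   ∎

  ⊕-zeros : ∀ {p q} → p ≋ 0P → q ≋ 0P → p ⊕ q ≋ 0P
  ⊕-zeros p≋0 q≋0 = ≃-trans (⊕-cong p≋0 q≋0) (⊕-idʳ _)

  -- Multiplication by zero is not an axiom: z = p ⊗ 0 satisfies z ≋ z ⊕ z,
  -- and adding the additive inverse of z to both sides gives z ≋ 0.
  ⊗-zeroʳ : ∀ p → p ⊗ 0P ≋ 0P
  ⊗-zeroʳ p = ≃-sym (begin
      0P            ≈⟨ ≃-sym (⊕-invʳ z) ⟩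
      z ⊕ -z        ≈⟨ ⊕-congʳ -z z≋z⊕z ⟩
      (z ⊕ z) ⊕ -z  ≈⟨ ⊕-assoc z z -z ⟩
      z ⊕ (z ⊕ -z)  ≈⟨ ⊕-congˡ z (⊕-invʳ z) ⟩
      z ⊕ 0P        ≈⟨ ⊕-idʳ z ⟩
      z             ∎)
    where
    z -z : Poly F
    z = p ⊗ 0P
    -z = con (- 1#) ⊗ z
    0≋0⊕0 : 0P ≋ 0P ⊕ 0P
    0≋0⊕0 = ≃-trans (con-cong (Field.sym F (+-identityʳ 0#))) (con-+ 0# 0#)
    z≋z⊕z : z ≋ z ⊕ z
    z≋z⊕z = ≃-trans (⊗-congˡ p 0≋0⊕0) (distribˡ p 0P 0P)

  ⊗-zeroˡ : ∀ p → 0P ⊗ p ≋ 0P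
  ⊗-zeroˡ p = ≃-trans (⊗-comm _ _) (⊗-zeroʳ p)

  ⊕-interchange : ∀ a b c d → (a ⊕ b) ⊕ (c ⊕ d) ≋ (a ⊕ c) ⊕ (b ⊕ d)
  ⊕-interchange a b c d = begin
    (a ⊕ b) ⊕ (c ⊕ d)  ≈⟨ ⊕-assoc a b (c ⊕ d) ⟩
    a ⊕ (b ⊕ (c ⊕ d))  ≈⟨ ⊕-congˡ a (≃-sym (⊕-assoc b c d)) ⟩
    a ⊕ ((b ⊕ c) ⊕ d)  ≈⟨ ⊕-congˡ a (⊕-congʳ d (⊕-comm b c)) ⟩
    a ⊕ ((c ⊕ b) ⊕ d)  ≈⟨ ⊕-congˡ a (⊕-assoc c b d) ⟩
    a ⊕ (c ⊕ (b ⊕ d))  ≈⟨ ≃-sym (⊕-assoc a c (b ⊕ d)) ⟩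
    (a ⊕ c) ⊕ (b ⊕ d)  ∎

  Σ< : ℕ → (ℕ → Poly F) → Poly F
  Σ< zero    g = 0P
  Σ< (suc n) g = g 0 ⊕ Σ< n (g ∘ suc)

  Σ<-cong : ∀ n {g h} → (∀ a → a < n → g a ≋ h a) → Σ< n g ≋ Σ< n h
  Σ<-cong zero    g≋h = ≃-refl
  Σ<-cong (suc n) g≋h = ⊕-cong (g≋h 0 (s≤s z≤n)) (Σ<-cong n (λ a a<n → g≋h (suc a) (s≤s a<n)))

  Σ<-zero : ∀ n {g} → (∀ a → a < n → g a ≋ 0P) → Σ< n g ≋ 0P
  Σ<-zero zero    g≋0 = ≃-refl
  Σ<-zero (suc n) g≋0 = ⊕-zeros (g≋0 0 (s≤s z≤n)) (Σ<-zero n (λ a a<n → g≋0 (suc a) (s≤s a<n)))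

  Σ<-⊕ : ∀ n g h → Σ< n (λ a → g a ⊕ h a) ≋ Σ< n g ⊕ Σ< n h
  Σ<-⊕ zero    g h = ≃-sym (⊕-idʳ 0P)
  Σ<-⊕ (suc n) g h = ≃-trans (⊕-congˡ _ (Σ<-⊕ n (g ∘ suc) (h ∘ suc))) (⊕-interchange _ _ _ _)

  Σ<-⊗ˡ : ∀ n x g → Σ< n (λ a → x ⊗ g a) ≋ x ⊗ Σ< n g
  Σ<-⊗ˡ zero    x g = ≃-sym (⊗-zeroʳ x)
  Σ<-⊗ˡ (suc n) x g = ≃-trans (⊕-congˡ _ (Σ<-⊗ˡ n x (g ∘ suc))) (≃-sym (distribˡ x _ _))

  Σ<-⊗ʳ : ∀ n x g → Σ< n (λ a → g a ⊗ x) ≋ Σ< n g ⊗ x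
  Σ<-⊗ʳ n x g = begin
    Σ< n (λ a → g a ⊗ x)  ≈⟨ Σ<-cong n (λ a _ → ⊗-comm (g a) x) ⟩
    Σ< n (λ a → x ⊗ g a)  ≈⟨ Σ<-⊗ˡ n x g ⟩
    x ⊗ Σ< n g            ≈⟨ ⊗-comm _ _ ⟩
    Σ< n g ⊗ x            ∎

  Σ<-snoc : ∀ n g → Σ< (suc n) g ≋ Σ< n g ⊕ g n
  Σ<-snoc zero    g = ≃-trans (⊕-idʳ _) (≃-sym (⊕-idˡ _))
  Σ<-snoc (suc n) g = ≃-trans (⊕-congˡ _ (Σ<-snoc n (g ∘ suc))) (≃-sym (⊕-assoc _ _ _))

  Σ<-reverse : ∀ n g → Σ< n g ≋ Σ< n (λ a → g (n ∸ suc a))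
  Σ<-reverse zero    g = ≃-refl
  Σ<-reverse (suc n) g = begin
    Σ< (suc n) g                       ≈⟨ Σ<-snoc n g ⟩
    Σ< n g ⊕ g n                       ≈⟨ ⊕-comm _ _ ⟩
    g n ⊕ Σ< n g                       ≈⟨ ⊕-congˡ (g n) (Σ<-reverse n g) ⟩
    g n ⊕ Σ< n (λ a → g (n ∸ suc a))   ∎

  Σ<-vanishing : ∀ {Q N} g → Q ≤ N → (∀ a → Q ≤ a → g a ≋ 0P) → Σ< N g ≋ Σ< Q g
  Σ<-vanishing {zero}  {N}     g _         g≋0 = Σ<-zero N (λ a _ → g≋0 a z≤n)
  Σ<-vanishing {suc Q} {suc N} g (s≤s Q≤N) g≋0 =
    ⊕-congˡ (g 0) (Σ<-vanishing (g ∘ suc) Q≤N (λ a Q≤a → g≋0 (suc a) (s≤s Q≤a)))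

  -- Convolution of coefficient sequences:  conv u v k = Σ_{a ≤ k} u a ⊗ v (k - a).
  -- Note that  conv u v (suc k) = u 0 ⊗ v (suc k) ⊕ conv (u ∘ suc) v k  holds by definition.
  conv : (ℕ → Poly F) → (ℕ → Poly F) → ℕ → Poly F
  conv u v k = Σ< (suc k) (λ a → u a ⊗ v (k ∸ a))

  conv-cong : ∀ {u u′ v v′} k → (∀ a → u a ≋ u′ a) → (∀ a → v a ≋ v′ a) → conv u v k ≋ conv u′ v′ k
  conv-cong k u≋u′ v≋v′ = Σ<-cong (suc k) (λ a _ → ⊗-cong (u≋u′ a) (v≋v′ (k ∸ a)))

  conv-comm : ∀ u v k → conv u v k ≋ conv v u k
  conv-comm u v k = ≃-trans (Σ<-reverse (suc k) (λ a → u a ⊗ v (k ∸ a))) (Σ<-cong (suc k) λ a a<1+k →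
    ≃-trans (⊗-comm _ _) (⊗-congʳ (u (k ∸ a)) (≡⇒≋ (≡.cong v (ℕₚ.m∸[m∸n]≡n (ℕₚ.≤-pred a<1+k))))))

  conv-⊕ˡ : ∀ u u′ v k → conv (λ a → u a ⊕ u′ a) v k ≋ conv u v k ⊕ conv u′ v k
  conv-⊕ˡ u u′ v k = ≃-trans (Σ<-cong (suc k) (λ a _ → distribʳ (u a) (u′ a) (v (k ∸ a))))
                             (Σ<-⊕ (suc k) (λ a → u a ⊗ v (k ∸ a)) (λ a → u′ a ⊗ v (k ∸ a)))

  conv-⊗ˡ : ∀ x u v k → conv (λ a → x ⊗ u a) v k ≋ x ⊗ conv u v k
  conv-⊗ˡ x u v k = ≃-trans (Σ<-cong (suc k) (λ a _ → ⊗-assoc x (u a) (v (k ∸ a))))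
                            (Σ<-⊗ˡ (suc k) x (λ a → u a ⊗ v (k ∸ a)))

  conv-concentrated : ∀ u v k → (∀ a → u (suc a) ≋ 0P) → conv u v k ≋ u 0 ⊗ v k
  conv-concentrated u v k u≋0 =
    ≃-trans (⊕-congˡ _ (Σ<-zero k (λ a _ → ≃-trans (⊗-congʳ _ (u≋0 a)) (⊗-zeroˡ _)))) (⊕-idʳ _)

  conv-assoc : ∀ u v w k → conv (conv u v) w k ≋ conv u (conv v w) k
  conv-assoc u v w zero    = ⊕-congʳ 0P (≃-trans (⊗-congʳ _ (⊕-idʳ _))
                                          (≃-trans (⊗-assoc _ _ _) (≃-sym (⊗-congˡ (u 0) (⊕-idʳ _)))))
  conv-assoc u v w (suc k) = begin
    conv (conv u v) w (suc k)
      ≡⟨⟩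
    (conv u v 0 ⊗ w (suc k)) ⊕ conv (λ a → (u 0 ⊗ v (suc a)) ⊕ conv us v a) w k
      ≈⟨ ⊕-congˡ _ (conv-⊕ˡ (λ a → u 0 ⊗ v (suc a)) (conv us v) w k) ⟩
    (conv u v 0 ⊗ w (suc k)) ⊕ (conv (λ a → u 0 ⊗ v (suc a)) w k ⊕ conv (conv us v) w k)
      ≈⟨ ⊕-congˡ _ (⊕-cong (conv-⊗ˡ (u 0) vs w k) (conv-assoc us v w k)) ⟩
    (conv u v 0 ⊗ w (suc k)) ⊕ ((u 0 ⊗ conv vs w k) ⊕ conv us (conv v w) k)
      ≈⟨ ≃-sym (⊕-assoc _ _ _) ⟩
    ((conv u v 0 ⊗ w (suc k)) ⊕ (u 0 ⊗ conv vs w k)) ⊕ conv us (conv v w) k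
      ≈⟨ ⊕-congʳ _ (⊕-congʳ _ (≃-trans (⊗-congʳ _ (⊕-idʳ _)) (⊗-assoc _ _ _))) ⟩
    ((u 0 ⊗ (v 0 ⊗ w (suc k))) ⊕ (u 0 ⊗ conv vs w k)) ⊕ conv us (conv v w) k
      ≈⟨ ⊕-congʳ _ (≃-sym (distribˡ _ _ _)) ⟩
    (u 0 ⊗ conv v w (suc k)) ⊕ conv us (conv v w) k
      ∎
    where
    us vs : ℕ → Poly F
    us = u ∘ suc
    vs = v ∘ suc

  conv-extremes : ∀ u v k → conv u v (suc k)
                  ≋ (u 0 ⊗ v (suc k)) ⊕ (Σ< k (λ a → u (suc a) ⊗ v (k ∸ a)) ⊕ (u (suc k) ⊗ v 0))
  conv-extremes u v k =
    ⊕-congˡ _ (≃-trans (Σ<-snoc k g) (⊕-congˡ _ (≡⇒≋ (≡.cong (λ z → u (suc k) ⊗ v z) (ℕₚ.n∸n≡0 k)))))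
    where
    g : ℕ → Poly F
    g a = u (suc a) ⊗ v (k ∸ a)

  cauchy : ∀ u v P Q → (∀ a → P < a → u a ≋ 0P) → (∀ a → Q < a → v a ≋ 0P) →
           Σ< (suc (P + Q)) (conv u v) ≋ Σ< (suc P) u ⊗ Σ< (suc Q) v
  cauchy u v zero Q u≋0 v≋0 = begin
    Σ< (suc Q) (conv u v)           ≈⟨ Σ<-cong (suc Q) (λ k _ → conv-concentrated u v k (λ a → u≋0 (suc a) (s≤s z≤n))) ⟩
    Σ< (suc Q) (λ k → u 0 ⊗ v k)    ≈⟨ Σ<-⊗ˡ (suc Q) (u 0) v ⟩
    u 0 ⊗ Σ< (suc Q) v              ≈⟨ ⊗-congʳ _ (≃-sym (⊕-idʳ (u 0))) ⟩
    Σ< 1 u ⊗ Σ< (suc Q) v           ∎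
  cauchy u v (suc P) Q u≋0 v≋0 = begin
    conv u v 0 ⊕ Σ< (suc (P + Q)) (λ k → (u 0 ⊗ v (suc k)) ⊕ conv us v k)
      ≈⟨ ⊕-cong (⊕-idʳ _) (Σ<-⊕ (suc (P + Q)) (λ k → u 0 ⊗ v (suc k)) (conv us v)) ⟩
    (u 0 ⊗ v 0) ⊕ (Σ< (suc (P + Q)) (λ k → u 0 ⊗ v (suc k)) ⊕ Σ< (suc (P + Q)) (conv us v))
      ≈⟨ ⊕-congˡ _ (⊕-cong (Σ<-⊗ˡ (suc (P + Q)) (u 0) (v ∘ suc))
                           (cauchy us v P Q (λ a P<a → u≋0 (suc a) (s≤s P<a)) v≋0)) ⟩
    (u 0 ⊗ v 0) ⊕ ((u 0 ⊗ Σ< (suc (P + Q)) (v ∘ suc)) ⊕ (Σ< (suc P) us ⊗ Σ< (suc Q) v))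
      ≈⟨ ≃-sym (⊕-assoc _ _ _) ⟩
    ((u 0 ⊗ v 0) ⊕ (u 0 ⊗ Σ< (suc (P + Q)) (v ∘ suc))) ⊕ (Σ< (suc P) us ⊗ Σ< (suc Q) v)
      ≈⟨ ⊕-congʳ _ (≃-sym (distribˡ _ _ _)) ⟩
    (u 0 ⊗ Σ< (suc (suc (P + Q))) v) ⊕ (Σ< (suc P) us ⊗ Σ< (suc Q) v)
      ≈⟨ ⊕-congʳ _ (⊗-congˡ (u 0) (Σ<-vanishing v (s≤s (ℕₚ.m≤n⇒m≤1+n (ℕₚ.m≤n+m Q P))) v≋0)) ⟩
    (u 0 ⊗ Σ< (suc Q) v) ⊕ (Σ< (suc P) us ⊗ Σ< (suc Q) v)
      ≈⟨ ≃-sym (distribʳ _ _ _) ⟩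
    Σ< (suc (suc P)) u ⊗ Σ< (suc Q) v
      ∎
    where
    us : ℕ → Poly F
    us = u ∘ suc

  component : ℕ → Poly F → Poly F
  component k       (p ⊕ q) = component k p ⊕ component k q
  component k       (p ⊗ q) = conv (λ a → component a p) (λ a → component a q) k
  component zero    (con a) = con a
  component (suc k) (con a) = 0P
  component zero          (var i) = 0P
  component (suc zero)    (var i) = var i
  component (suc (suc k)) (var i) = 0P

  constantTerm : Poly F → Carrier
  constantTerm (con a) = a
  constantTerm (var i) = 0#
  constantTerm (p ⊕ q) = constantTerm p +ꟳ constantTerm q
  constantTerm (p ⊗ q) = constantTerm p *ꟳ constantTerm q

  component-zero : ∀ p → component 0 p ≋ con (constantTerm p)
  component-zero (con a) = ≃-refl
  component-zero (var i) = ≃-refl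
  component-zero (p ⊕ q) = ≃-trans (⊕-cong (component-zero p) (component-zero q)) (≃-sym (con-+ _ _))
  component-zero (p ⊗ q) =
    ≃-trans (⊕-idʳ _) (≃-trans (⊗-cong (component-zero p) (component-zero q)) (≃-sym (con-* _ _)))

  component-0P : ∀ k → component k 0P ≋ 0P
  component-0P zero    = ≃-refl
  component-0P (suc k) = ≃-refl

  component-scalar : ∀ a p k → component k (con a ⊗ p) ≋ con a ⊗ component k p
  component-scalar a p k = conv-concentrated (λ j → component j (con a)) (λ j → component j p) k (λ _ → ≃-refl)

  -- Taking components respects equality of polynomials: every axiom of _≃_
  -- becomes an identity of sums and convolutions.
  component-resp : ∀ {p q} → p ≋ q → ∀ k → component k p ≋ component k q
  component-resp ≃-refl           k = ≃-refl
  component-resp (≃-sym e)        k = ≃-sym (component-resp e k)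
  component-resp (≃-trans e e′)   k = ≃-trans (component-resp e k) (component-resp e′ k)
  component-resp (⊕-cong e e′)    k = ⊕-cong (component-resp e k) (component-resp e′ k)
  component-resp (⊗-cong e e′)    k = conv-cong k (component-resp e) (component-resp e′)
  component-resp (con-cong a≈b) zero    = con-cong a≈b
  component-resp (con-cong a≈b) (suc k) = ≃-refl
  component-resp (con-+ a b) zero    = con-+ a b
  component-resp (con-+ a b) (suc k) = ≃-sym (⊕-idʳ 0P)
  component-resp (con-* a b) zero    = ≃-trans (con-* a b) (≃-sym (⊕-idʳ _))
  component-resp (con-* a b) (suc k) = ≃-sym (≃-trans (component-scalar a (con b) (suc k)) (⊗-zeroʳ _))
  component-resp (⊕-assoc p q r)  k = ⊕-assoc _ _ _
  component-resp (⊕-comm p q)     k = ⊕-comm _ _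
  component-resp (⊕-idʳ p)        k = ≃-trans (⊕-congˡ _ (component-0P k)) (⊕-idʳ _)
  component-resp (⊕-invʳ p)       k =
    ≃-trans (⊕-congˡ _ (component-scalar (- 1#) p k)) (≃-trans (⊕-invʳ _) (≃-sym (component-0P k)))
  component-resp (⊗-assoc p q r)  k = conv-assoc (λ j → component j p) (λ j → component j q) (λ j → component j r) k
  component-resp (⊗-comm p q)     k = conv-comm (λ j → component j p) (λ j → component j q) k
  component-resp (⊗-idʳ p)        k =
    ≃-trans (conv-comm (λ j → component j p) (λ j → component j 1P) k)
            (≃-trans (component-scalar 1# p k) (⊗-idˡ _))
  component-resp (distribʳ p q r) k = conv-⊕ˡ (λ j → component j p) (λ j → component j q) (λ j → component j r) k

  component-high : ∀ p k → fdeg F p < k → component k p ≋ 0P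
  component-high (con a) (suc k)       _ = ≃-refl
  component-high (var i) (suc (suc k)) _ = ≃-refl
  component-high (var i) (suc zero)    (s≤s ())
  component-high (p ⊕ q) k d<k =
    ⊕-zeros (component-high p k (ℕₚ.≤-<-trans (ℕₚ.m≤m⊔n (fdeg F p) (fdeg F q)) d<k))
            (component-high q k (ℕₚ.≤-<-trans (ℕₚ.m≤n⊔m (fdeg F p) (fdeg F q)) d<k))
  component-high (p ⊗ q) k d<k = Σ<-zero (suc k) term
    where
    term : ∀ a → a < suc k → component a p ⊗ component (k ∸ a) q ≋ 0P
    term a _ with degree-split a d<k
    ... | inj₁ dp<a   = ≃-trans (⊗-congʳ _ (component-high p a dp<a)) (⊗-zeroˡ _)
    ... | inj₂ dq<k-a = ≃-trans (⊗-congˡ _ (component-high q (k ∸ a) dq<k-a)) (⊗-zeroʳ _)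

  truncate : ℕ → Poly F → Poly F
  truncate D p = Σ< (suc D) (λ k → component k p)

  truncate-resp : ∀ {p q} D → p ≋ q → truncate D p ≋ truncate D q
  truncate-resp D e = Σ<-cong (suc D) (λ k _ → component-resp e k)

  truncate-above : ∀ p {D} → fdeg F p ≤ D → truncate D p ≋ truncate (fdeg F p) p
  truncate-above p d≤D = Σ<-vanishing (λ k → component k p) (s≤s d≤D) (component-high p)

  truncate-fdeg : ∀ p → truncate (fdeg F p) p ≋ p
  truncate-fdeg (con a) = ⊕-idʳ _
  truncate-fdeg (var i) = ≃-trans (⊕-idˡ _) (⊕-idʳ _)
  truncate-fdeg (p ⊕ q) = ≃-trans (Σ<-⊕ (suc D) (λ k → component k p) (λ k → component k q))
      (⊕-cong (≃-trans (truncate-above p (ℕₚ.m≤m⊔n _ _)) (truncate-fdeg p))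
              (≃-trans (truncate-above q (ℕₚ.m≤n⊔m _ _)) (truncate-fdeg q)))
    where
    D : ℕ
    D = fdeg F p ℕ.⊔ fdeg F q
  truncate-fdeg (p ⊗ q) =
    ≃-trans (cauchy (λ k → component k p) (λ k → component k q) (fdeg F p) (fdeg F q)
                    (component-high p) (component-high q))
            (⊗-cong (truncate-fdeg p) (truncate-fdeg q))

  truncate-id : ∀ p {D} → fdeg F p ≤ D → truncate D p ≋ p
  truncate-id p d≤D = ≃-trans (truncate-above p d≤D) (truncate-fdeg p)

  truncate-DegreeAtMost : ∀ {p D} → DegreeAtMost F p D → truncate D p ≋ p
  truncate-DegreeAtMost {D = D} (e , e≋p , deg-e) =
    ≃-trans (truncate-resp D (≃-sym e≋p)) (≃-trans (truncate-id e deg-e) e≋p)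

  Σᴸ : List (Poly F) → Poly F
  Σᴸ = foldr _⊕_ 0P

  Σᴸ-++ : ∀ xs ys → Σᴸ (xs ++ ys) ≋ Σᴸ xs ⊕ Σᴸ ys
  Σᴸ-++ []       ys = ≃-sym (⊕-idˡ _)
  Σᴸ-++ (x ∷ xs) ys = ≃-trans (⊕-congˡ x (Σᴸ-++ xs ys)) (≃-sym (⊕-assoc _ _ _))

  Σᴸ-tabulate : ∀ n (t : Fin n → Poly F) g → (∀ a → t a ≋ g (toℕ a)) → Σᴸ (tabulate t) ≋ Σ< n g
  Σᴸ-tabulate zero    t g t≋g = ≃-refl
  Σᴸ-tabulate (suc n) t g t≋g = ⊕-cong (t≋g Fin.zero) (Σᴸ-tabulate n (t ∘ Fin.suc) (g ∘ suc) (t≋g ∘ Fin.suc))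

  Σᴸ-tabulate-zero : ∀ n (t : Fin n → Poly F) → (∀ a → t a ≋ 0P) → Σᴸ (tabulate t) ≋ 0P
  Σᴸ-tabulate-zero n t t≋0 = ≃-trans (Σᴸ-tabulate n t (λ _ → 0P) t≋0) (Σ<-zero n (λ _ _ → ≃-refl))

  Σᴸ-map-tabulate-++ : ∀ {a} {A : Set a} (V : A → Poly F) {n} (t : Fin n → A) xs →
                       Σᴸ (map V (tabulate t ++ xs)) ≋ Σᴸ (tabulate (V ∘ t)) ⊕ Σᴸ (map V xs)
  Σᴸ-map-tabulate-++ V t xs = begin
    Σᴸ (map V (tabulate t ++ xs))             ≡⟨ ≡.cong Σᴸ (Listₚ.map-++ V (tabulate t) xs) ⟩
    Σᴸ (map V (tabulate t) ++ map V xs)       ≈⟨ Σᴸ-++ (map V (tabulate t)) (map V xs) ⟩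
    Σᴸ (map V (tabulate t)) ⊕ Σᴸ (map V xs)   ≡⟨ ≡.cong (λ ys → Σᴸ ys ⊕ Σᴸ (map V xs)) (Listₚ.map-tabulate t V) ⟩
    Σᴸ (tabulate (V ∘ t)) ⊕ Σᴸ (map V xs)     ∎

  Σᴸ-tabulate-single : ∀ n (t : Fin n → Poly F) b → (∀ a → a ≢ b → t a ≋ 0P) → Σᴸ (tabulate t) ≋ t b
  Σᴸ-tabulate-single (suc n) t Fin.zero t≋0 =
    ≃-trans (⊕-congˡ _ (Σᴸ-tabulate-zero n (t ∘ Fin.suc) (λ a → t≋0 (Fin.suc a) λ ()))) (⊕-idʳ _)
  Σᴸ-tabulate-single (suc n) t (Fin.suc b) t≋0 =
    ≃-trans (⊕-cong (t≋0 Fin.zero λ ()) (Σᴸ-tabulate-single n (t ∘ Fin.suc) b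
                    (λ a a≢b → t≋0 (Fin.suc a) (a≢b ∘ Finₚ.suc-injective))))
            (⊕-idˡ _)

-- A sequence is realizable iff running it from the empty stack
-- succeeds with the empty stack.
module StackMachine {c ℓ : Level} (F : Field c ℓ) {k : ℕ} where

  Stack : Set
  Stack = List (Fin k)

  Op : Set
  Op = StackOp F k

  apply : Stack → Op → Maybe Stack
  apply w       (push s) = just (s ∷ w)
  apply []      (pop s)  = nothing
  apply (t ∷ w) (pop s) with s Fin.≟ t
  ... | yes _ = just w
  ... | no  _ = nothing
  apply w       nop      = just w

  mutual
    run : Stack → List Op → Maybe Stack
    run w []       = just w
    run w (o ∷ os) = runFrom (apply w o) os

    runFrom : Maybe Stack → List Op → Maybe Stack
    runFrom nothing  os = nothing
    runFrom (just w) os = run w os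

  run-++ : ∀ w P Q → run w (P ++ Q) ≡ runFrom (run w P) Q
  runFrom-++ : ∀ r P Q → runFrom r (P ++ Q) ≡ runFrom (runFrom r P) Q
  run-++ w []      Q = refl
  run-++ w (o ∷ P) Q = runFrom-++ (apply w o) P Q
  runFrom-++ nothing  P Q = refl
  runFrom-++ (just w) P Q = run-++ w P Q

  apply-pop-top : ∀ s w → apply (s ∷ w) (pop s) ≡ just w
  apply-pop-top s w with s Fin.≟ s
  ... | yes _ = refl
  ... | no s≢s = ⊥-elim (s≢s refl)

  apply-pop-other : ∀ s t w → ¬ s ≡ t → apply (t ∷ w) (pop s) ≡ nothing
  apply-pop-other s t w s≢t with s Fin.≟ t
  ... | yes s≡t = ⊥-elim (s≢t s≡t)
  ... | no  _   = refl

  realizable⇒run : ∀ {P} → Realizable F P → ∀ w → run w P ≡ just w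
  realizable⇒run empty w = refl
  realizable⇒run (wrap s {P} r) w
    rewrite run-++ (s ∷ w) P (pop s ∷ []) | realizable⇒run r (s ∷ w) | apply-pop-top s w = refl
  realizable⇒run (nopˡ r) w = realizable⇒run r w
  realizable⇒run (nopʳ {P} r) w rewrite run-++ w P (nop ∷ []) | realizable⇒run r w = refl
  realizable⇒run (concat {P} {Q} r r′) w rewrite run-++ w P Q | realizable⇒run r w = realizable⇒run r′ w

  -- Splitting P according to the stack s₁ ∷ … ∷ sₙ it has to empty:
  -- P = Q₁ pop(s₁) Q₂ pop(s₂) … Qₙ pop(sₙ) Qₙ₊₁ with every Qᵢ realizable.
  Split : Stack → List Op → Set
  Split []      P = Realizable F P
  Split (s ∷ w) P = Σ[ Q ∈ List Op ] Σ[ R ∈ List Op ]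
                      (P ≡ Q ++ pop s ∷ R × Realizable F Q × Split w R)

  Split-nop : ∀ w {P} → Split w P → Split w (nop ∷ P)
  Split-nop []      sp = nopˡ sp
  Split-nop (s ∷ w) (Q , R , refl , rQ , sp) = nop ∷ Q , R , refl , nopˡ rQ , sp

  Split-prefix : ∀ w {X R} → Realizable F X → Split w R → Split w (X ++ R)
  Split-prefix []      rX sp = concat rX sp
  Split-prefix (s ∷ w) {X} rX (Q , R , refl , rQ , sp) =
    X ++ Q , R , ≡.sym (Listₚ.++-assoc X Q (pop s ∷ R)) , concat rX rQ , sp

  run⇒Split : ∀ w P → run w P ≡ just [] → Split w P
  run⇒Split []      []           _ = empty
  run⇒Split (_ ∷ _) []           ()
  run⇒Split w       (nop ∷ P)    e = Split-nop w (run⇒Split w P e)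
  run⇒Split w       (push s ∷ P) e with run⇒Split (s ∷ w) P e
  ... | Q , R , refl , rQ , sp =
    ≡.subst (Split w) (Listₚ.++-assoc (push s ∷ Q) (pop s ∷ []) R) (Split-prefix w (wrap s rQ) sp)
  run⇒Split []      (pop s ∷ P)  ()
  run⇒Split (t ∷ w) (pop s ∷ P)  e with s Fin.≟ t
  run⇒Split (t ∷ w) (pop s ∷ P)  e  | yes refl = [] , P , refl , empty , run⇒Split w P e
  run⇒Split (t ∷ w) (pop s ∷ P)  () | no _

  run⇒realizable : ∀ P → run [] P ≡ just [] → Realizable F P
  run⇒realizable = run⇒Split []

  rejected : ∀ {P o} → run [] P ≡ o → ¬ o ≡ just [] → ¬ Realizable F P
  rejected eq o≢ real = o≢ (≡.trans (≡.sym eq) (realizable⇒run real []))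

module WalkSums {c ℓ : Level} (F : Field c ℓ) (B : SBP F) where
  open SBP B
  open StackMachine F {k}
  open PolyAlgebra F
  open ≋-Reasoning

  E : Set c
  E = Edge F m k

  ops : List E → List Op
  ops = map Edge.op

  edgeWeight : E → Poly F
  edgeWeight e = wPoly F B (Edge.weight e)

  accept : Maybe Stack → Poly F → Poly F
  accept (just [])      x = x
  accept (just (_ ∷ _)) x = 0P
  accept nothing        x = 0P

  Σwalks : Stack → List (List E) → Poly F
  Σwalks w []       = 0P
  Σwalks w (P ∷ Ps) = accept (run w (ops P)) (pathWeight F B P) ⊕ Σwalks w Ps

  walkSum : ℕ → Fin m → Stack → Poly F
  walkSum f u w = Σwalks w (walksToSink F B f u)

  Σwalks-++ : ∀ w Ps Qs → Σwalks w (Ps ++ Qs) ≋ Σwalks w Ps ⊕ Σwalks w Qs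
  Σwalks-++ w []       Qs = ≃-sym (⊕-idˡ _)
  Σwalks-++ w (P ∷ Ps) Qs = ≃-trans (⊕-congˡ _ (Σwalks-++ w Ps Qs)) (≃-sym (⊕-assoc _ _ _))

  continue : Maybe Stack → Poly F → (Stack → Poly F) → Poly F
  continue nothing   x g = 0P
  continue (just w′) x g = x ⊗ g w′

  viaEdge : ℕ → Stack → E → Poly F
  viaEdge f w e = continue (apply w (Edge.op e)) (edgeWeight e) (walkSum f (Edge.to e))

  Σwalks-prefix : ∀ w e Ps →
    Σwalks w (map (e ∷_) Ps) ≋ continue (apply w (Edge.op e)) (edgeWeight e) (λ w′ → Σwalks w′ Ps)
  Σwalks-prefix w e Ps = ≃-trans (≡⇒≋ (Σwalks-map Ps)) (Σfrom-continue (apply w (Edge.op e)) Ps)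
    where
    x : Poly F
    x = edgeWeight e
    Σfrom : Maybe Stack → List (List E) → Poly F
    Σfrom r []       = 0P
    Σfrom r (P ∷ Ps) = accept (runFrom r (ops P)) (x ⊗ pathWeight F B P) ⊕ Σfrom r Ps
    Σwalks-map : ∀ Ps → Σwalks w (map (e ∷_) Ps) ≡ Σfrom (apply w (Edge.op e)) Ps
    Σwalks-map []       = refl
    Σwalks-map (P ∷ Ps) = ≡.cong (_ ⊕_) (Σwalks-map Ps)
    accept-⊗ : ∀ r y → accept r (x ⊗ y) ≋ x ⊗ accept r y
    accept-⊗ (just [])      y = ≃-refl
    accept-⊗ (just (_ ∷ _)) y = ≃-sym (⊗-zeroʳ x)
    accept-⊗ nothing        y = ≃-sym (⊗-zeroʳ x)
    Σfrom-continue : ∀ r Ps → Σfrom r Ps ≋ continue r x (λ w′ → Σwalks w′ Ps)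
    Σfrom-continue nothing   []       = ≃-refl
    Σfrom-continue nothing   (P ∷ Ps) = ≃-trans (⊕-idˡ _) (Σfrom-continue nothing Ps)
    Σfrom-continue (just w′) []       = ≃-sym (⊗-zeroʳ x)
    Σfrom-continue (just w′) (P ∷ Ps) =
      ≃-trans (⊕-cong (accept-⊗ (run w′ (ops P)) (pathWeight F B P)) (Σfrom-continue (just w′) Ps))
              (≃-sym (distribˡ _ _ _))

  walksVia : ℕ → E → List (List E)
  walksVia f e = map (e ∷_) (walksToSink F B f (Edge.to e))

  outgoing : Fin m → List E
  outgoing u = filter (λ e → Edge.from e Fin.≟ u) edges

  walksToSink-suc : ∀ f u → walksToSink F B (suc f) u ≡ walksToSink F B 0 u ++ concatMap (walksVia f) (outgoing u)
  walksToSink-suc f u with u Fin.≟ sink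
  ... | yes _ = refl
  ... | no  _ = refl

  Σwalks-concatMap : ∀ f w es → Σwalks w (concatMap (walksVia f) es) ≋ Σᴸ (map (viaEdge f w) es)
  Σwalks-concatMap f w []       = ≃-refl
  Σwalks-concatMap f w (e ∷ es) = begin
    Σwalks w (walksVia f e ++ concatMap (walksVia f) es)
      ≈⟨ Σwalks-++ w (walksVia f e) (concatMap (walksVia f) es) ⟩
    Σwalks w (walksVia f e) ⊕ Σwalks w (concatMap (walksVia f) es)
      ≈⟨ ⊕-cong (Σwalks-prefix w e _) (Σwalks-concatMap f w es) ⟩
    viaEdge f w e ⊕ Σᴸ (map (viaEdge f w) es)
      ∎

  walkSum-suc : ∀ f u w → walkSum (suc f) u w ≋ walkSum 0 u w ⊕ Σᴸ (map (viaEdge f w) (outgoing u))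
  walkSum-suc f u w = begin
    walkSum (suc f) u w
      ≡⟨ ≡.cong (Σwalks w) (walksToSink-suc f u) ⟩
    Σwalks w (walksToSink F B 0 u ++ concatMap (walksVia f) (outgoing u))
      ≈⟨ Σwalks-++ w (walksToSink F B 0 u) _ ⟩
    walkSum 0 u w ⊕ Σwalks w (concatMap (walksVia f) (outgoing u))
      ≈⟨ ⊕-congˡ _ (Σwalks-concatMap f w (outgoing u)) ⟩
    walkSum 0 u w ⊕ Σᴸ (map (viaEdge f w) (outgoing u))
      ∎

  Σwalks-realizable : ∀ Ps → Σ[ r ∈ Poly F ] (SumRealizable F B Ps r × r ≋ Σwalks [] Ps)
  Σwalks-realizable []       = 0P , sum-nil , ≃-refl
  Σwalks-realizable (P ∷ Ps) with Σwalks-realizable Ps | run [] (ops P) in eq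
  ... | r , sr , r≋ | just []      = pathWeight F B P ⊕ r , sum-yes (run⇒realizable (ops P) eq) sr , ⊕-congˡ _ r≋
  ... | r , sr , r≋ | just (_ ∷ _) = r , sum-no (rejected eq λ ()) sr , ≃-trans r≋ (≃-sym (⊕-idˡ _))
  ... | r , sr , r≋ | nothing      = r , sum-no (rejected eq λ ()) sr , ≃-trans r≋ (≃-sym (⊕-idˡ _))

  walkSum⇒computes : ∀ {p} → walkSum m source [] ≋ p → SBPComputes F B p
  walkSum⇒computes {p} e with Σwalks-realizable (paths F B)
  ... | r , sr , r≋ = r , sr , ≃-trans r≋ e

  acyclic-by-rank : (rank : Fin m → ℕ) → All (λ e → rank (Edge.from e) < rank (Edge.to e)) edges → Acyclic F B
  acyclic-by-rank rank up here                  = refl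
  acyclic-by-rank rank up (step e e∈ refl walk) =
    ⊥-elim (ℕₚ.<-irrefl refl (ℕₚ.<-≤-trans (All.lookup up e∈) (rank-mono walk)))
    where
    rank-mono : ∀ {u v es} → Walk F B u v es → rank u ≤ rank v
    rank-mono here                  = ℕₚ.≤-refl
    rank-mono (step e e∈ refl walk) = ℕₚ.<⇒≤ (ℕₚ.<-≤-trans (All.lookup up e∈) (rank-mono walk))

concat-tabulate-single : ∀ {a} {A : Set a} {n} (G : Fin n → List A) u →
                         (∀ v → v ≢ u → G v ≡ []) → List.concat (tabulate G) ≡ G u
concat-tabulate-single {n = suc n} G Fin.zero G≡[] =
  ≡.trans (≡.cong (G Fin.zero ++_) (rest-empty n (G ∘ Fin.suc) (λ v → G≡[] (Fin.suc v) λ ())))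
          (Listₚ.++-identityʳ (G Fin.zero))
  where
  rest-empty : ∀ n (H : Fin n → List _) → (∀ v → H v ≡ []) → List.concat (tabulate H) ≡ []
  rest-empty zero    H H≡[] = refl
  rest-empty (suc n) H H≡[] rewrite H≡[] Fin.zero = rest-empty n (H ∘ Fin.suc) (H≡[] ∘ Fin.suc)
concat-tabulate-single {n = suc n} G (Fin.suc u) G≡[] rewrite G≡[] Fin.zero (λ ()) =
  concat-tabulate-single (G ∘ Fin.suc) u (λ v v≢u → G≡[] (Fin.suc v) (v≢u ∘ Finₚ.suc-injective))

filter-concat : ∀ {a p} {A : Set a} {P : A → Set p} (P? : Decidable P) xss →
                filter P? (List.concat xss) ≡ List.concat (map (filter P?) xss)
filter-concat P? []         = refl
filter-concat P? (xs ∷ xss) =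
  ≡.trans (Listₚ.filter-++ P? xs (List.concat xss)) (≡.cong (filter P? xs ++_) (filter-concat P? xss))

-- The gate structure of a circuit: inputs of a +/× gate have larger
-- indices (they were added earlier).
module Circuits {c ℓ : Level} (F : Field c ℓ) where

  data GateView {n} (C : Circuit F n) (g : Fin n) : Set c where
    isConst   : ∀ a → gateVal F C g ≡ con a → GateView C g
    isVar     : ∀ i → gateVal F C g ≡ var i → GateView C g
    isSum     : ∀ i j → toℕ g < toℕ i → toℕ g < toℕ j →
                gateVal F C g ≡ gateVal F C i ⊕ gateVal F C j → GateView C g
    isProduct : ∀ i j → toℕ g < toℕ i → toℕ g < toℕ j →
                gateVal F C g ≡ gateVal F C i ⊗ gateVal F C j → GateView C g

  gateView : ∀ {n} (C : Circuit F n) g → GateView C g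
  gateView (C ▷ cgate a)   Fin.zero = isConst a refl
  gateView (C ▷ xgate i)   Fin.zero = isVar i refl
  gateView (C ▷ +gate i j) Fin.zero = isSum (Fin.suc i) (Fin.suc j) (s≤s z≤n) (s≤s z≤n) refl
  gateView (C ▷ ×gate i j) Fin.zero = isProduct (Fin.suc i) (Fin.suc j) (s≤s z≤n) (s≤s z≤n) refl
  gateView (C ▷ _) (Fin.suc g) with gateView C g
  ... | isConst a e           = isConst a e
  ... | isVar i e             = isVar i e
  ... | isSum i j g<i g<j e     = isSum (Fin.suc i) (Fin.suc j) (s≤s g<i) (s≤s g<j) e
  ... | isProduct i j g<i g<j e = isProduct (Fin.suc i) (Fin.suc j) (s≤s g<i) (s≤s g<j) e

module Construction {c ℓ : Level} (F : Field c ℓ) {s : ℕ} (C : Circuit F (suc s)) (D : ℕ) where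
  open Field F using (1#)
  open PolyAlgebra F
  open Circuits F

  N K : ℕ
  N = suc s
  K = N * D

  -- The stack symbol  task j r  records that component r+1 of gate j is
  -- still to be computed.
  task : Fin N → Fin D → Fin K
  task = combine

  taskGate : Fin K → Fin N
  taskGate y = proj₁ (remQuot {N} D y)

  taskDegree : Fin K → Fin D
  taskDegree y = proj₂ (remQuot {N} D y)

  -- node g k c computes component k+1 of gate g when c degrees have been
  -- produced so far; ret c pops the next task.
  data Vertex : Set where
    source sink : Vertex
    node : Fin N → Fin D → Fin (suc D) → Vertex
    ret  : Fin (suc D) → Vertex

  nodeCount m : ℕ
  nodeCount = N * (D * suc D)
  m = 2 + (nodeCount + suc D)

  enc : Vertex → Fin m
  enc source       = Fin.zero
  enc sink         = Fin.suc Fin.zero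
  enc (node g k c) = Fin.suc (Fin.suc (combine g (combine k c) ↑ˡ suc D))
  enc (ret c)      = Fin.suc (Fin.suc (nodeCount ↑ʳ c))

  decodeNode : Fin nodeCount → Vertex
  decodeNode y = uncurry (λ g kc → uncurry (node g) (remQuot (suc D) kc)) (remQuot (D * suc D) y)

  decodeRest : Fin nodeCount ⊎ Fin (suc D) → Vertex
  decodeRest (inj₁ y) = decodeNode y
  decodeRest (inj₂ c) = ret c

  dec : Fin m → Vertex
  dec Fin.zero              = source
  dec (Fin.suc Fin.zero)    = sink
  dec (Fin.suc (Fin.suc x)) = decodeRest (splitAt nodeCount x)

  dec-enc : ∀ X → dec (enc X) ≡ X
  dec-enc source = refl
  dec-enc sink   = refl
  dec-enc (node g k c) = begin
    decodeRest (splitAt nodeCount (combine g (combine k c) ↑ˡ suc D))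
      ≡⟨ ≡.cong decodeRest (Finₚ.splitAt-↑ˡ nodeCount (combine g (combine k c)) (suc D)) ⟩
    uncurry (λ g kc → uncurry (node g) (remQuot (suc D) kc)) (remQuot (D * suc D) (combine g (combine k c)))
      ≡⟨ ≡.cong (uncurry (λ g kc → uncurry (node g) (remQuot (suc D) kc))) (Finₚ.remQuot-combine g (combine k c)) ⟩
    uncurry (node g) (remQuot (suc D) (combine k c))
      ≡⟨ ≡.cong (uncurry (node g)) (Finₚ.remQuot-combine k c) ⟩
    node g k c
      ∎
    where open ≡.≡-Reasoning
  dec-enc (ret c) rewrite Finₚ.splitAt-↑ʳ nodeCount (suc D) c = refl

  taskGate-task : ∀ j r → taskGate (task j r) ≡ j
  taskGate-task j r = ≡.cong proj₁ (Finₚ.remQuot-combine j r)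

  taskDegree-task : ∀ j r → taskDegree (task j r) ≡ r
  taskDegree-task j r = ≡.cong proj₂ (Finₚ.remQuot-combine j r)

  val : Fin N → Poly F
  val = gateVal F C

  output : Poly F
  output = val Fin.zero

  E : Set c
  E = Edge F m K

  arc : Fin m → Vertex → Weight F → StackOp F K → E
  arc u Y w o = edge u (enc Y) w o

  one : Weight F
  one = wconst 1#

  -- Initial counter of the node computing component k+1 of the output:
  -- D - (k+1), so that all degrees are produced exactly when it reaches D.
  initial : Fin D → Fin (suc D)
  initial k = fromℕ< (s≤s (ℕₚ.m∸n≤m D (suc (toℕ k))))

  sourceEdges : Fin m → List E
  sourceEdges u = tabulate (λ k → arc u (node Fin.zero k (initial k)) one nop)
               ++ arc u sink (wconst (constantTerm output)) nop ∷ []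

  -- a variable gate has only a degree-1 component; it produces one degree
  varEdges : Fin m → Fin (suc D) → ℕ → ℕ → List E
  varEdges u c i zero with suc (toℕ c) <? suc D
  ... | yes c+1≤D = arc u (ret (fromℕ< c+1≤D)) (wvar i) nop ∷ []
  ... | no  _     = []
  varEdges u c i (suc _) = []

  rest : (k : Fin D) → Fin (toℕ k) → Fin D
  rest k a = fromℕ< (ℕₚ.≤-<-trans (ℕₚ.m∸n≤m (toℕ k) (suc (toℕ a))) (Finₚ.toℕ<n k))

  -- component k+1 of  val i ⊗ val j  is  Σ_{a ≤ k+1} (component a of i) ⊗
  -- (component k+1-a of j):  the extreme terms use the constant terms as
  -- weights, the middle ones compute component a+1 of i and push the
  -- task for component k-a of j.
  productEdges : Fin m → Fin N → Fin N → Fin D → Fin (suc D) → List E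
  productEdges u i j k c =
    arc u (node j k c) (wconst (constantTerm (val i))) nop
    ∷ tabulate (λ a → arc u (node i (Fin.inject a) c) one (push (task j (rest k a))))
    ++ arc u (node i k c) (wconst (constantTerm (val j))) nop ∷ []

  -- a constant has no component of positive degree; a sum gate branches
  -- to its inputs
  nodeEdges : Fin m → (g : Fin N) → Fin D → Fin (suc D) → GateView C g → List E
  nodeEdges u g k c (isConst a _)           = []
  nodeEdges u g k c (isVar i _)             = varEdges u c i (toℕ k)
  nodeEdges u g k c (isSum i j _ _ _)       = arc u (node i k c) one nop ∷ arc u (node j k c) one nop ∷ []
  nodeEdges u g k c (isProduct i j _ _ _)   = productEdges u i j k c

  finishEdges : Fin m → Fin (suc D) → List E
  finishEdges u c with toℕ c ℕ.≟ D
  ... | yes _ = arc u sink one nop ∷ []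
  ... | no  _ = []

  retEdges : Fin m → Fin (suc D) → List E
  retEdges u c = tabulate (λ y → arc u (node (taskGate y) (taskDegree y) c) one (pop y)) ++ finishEdges u c

  out : Fin m → Vertex → List E
  out u source       = sourceEdges u
  out u sink         = []
  out u (node g k c) = nodeEdges u g k c (gateView C g)
  out u (ret c)      = retEdges u c

  program : SBP F
  program = record
    { m = m ; k = K ; edges = List.concat (tabulate (λ u → out u (dec u)))
    ; source = enc source ; sink = enc sink }

  -- A rank on vertices that increases along every edge: the counter c is
  -- the major key, then gates in circuit order; ret c comes before the
  -- nodes with counter c.  R exceeds the rank offset of every gate.
  R : ℕ
  R = suc (N * D)

  nodeRank : Fin N → Fin (suc D) → ℕ
  nodeRank g c = suc (toℕ c * R + suc (toℕ g))

  rank : Vertex → ℕ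
  rank source       = 0
  rank (ret c)      = suc (toℕ c * R)
  rank (node g k c) = nodeRank g c
  rank sink         = suc (suc D * R)

  -- (only nodes have gate offsets, and a node's k : Fin D shows D > 0)
  gate<R : (g : Fin N) (k : Fin D) → suc (toℕ g) < R
  gate<R g k = s≤s (ℕₚ.<-≤-trans (Finₚ.toℕ<n g) (ℕₚ.m≤m*n N D {{D≢0}}))
    where
    D≢0 : ℕ.NonZero D
    D≢0 = ℕ.>-nonZero (ℕₚ.≤-<-trans z≤n (Finₚ.toℕ<n k))

  counter≤D : (c : Fin (suc D)) → toℕ c ≤ D
  counter≤D c = ℕₚ.≤-pred (Finₚ.toℕ<n c)

  rank-node-node : ∀ {g i} c → toℕ g < toℕ i → nodeRank g c < nodeRank i c
  rank-node-node c g<i = s≤s (ℕₚ.+-monoʳ-< (toℕ c * R) (s≤s g<i))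

  rank-node-ret : ∀ {g c c′} (k : Fin D) → toℕ c′ ≡ suc (toℕ c) → nodeRank g c < rank (ret c′)
  rank-node-ret {g} {c} k c′≡1+c rewrite c′≡1+c =
    s≤s (≡.subst (_< R + toℕ c * R) (ℕₚ.+-comm (suc (toℕ g)) (toℕ c * R))
                 (ℕₚ.+-monoˡ-< (toℕ c * R) (gate<R g k)))

  rank-ret-node : ∀ {g c} → rank (ret c) < nodeRank g c
  rank-ret-node {c = c} = s≤s (ℕₚ.m<m+n (toℕ c * R) (s≤s z≤n))

  rank-ret-sink : ∀ {c} → toℕ c ≡ D → rank (ret c) < rank sink
  rank-ret-sink c≡D rewrite c≡D = s≤s (s≤s (ℕₚ.m≤n+m (D * R) (N * D)))

  rank<sink : ∀ X → X ≢ sink → rank X < rank sink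
  rank<sink source       _ = s≤s z≤n
  rank<sink sink         X≢sink = ⊥-elim (X≢sink refl)
  rank<sink (node g k c) _ = s≤s (ℕₚ.<-≤-trans (ℕₚ.+-monoʳ-< (toℕ c * R) (gate<R g k))
    (ℕₚ.≤-trans (ℕₚ.≤-reflexive (ℕₚ.+-comm (toℕ c * R) R)) (ℕₚ.+-monoʳ-≤ R (ℕₚ.*-monoˡ-≤ R (counter≤D c)))))
  rank<sink (ret c)      _ = s≤s (ℕₚ.<-≤-trans (ℕₚ.m<n+m (toℕ c * R) (s≤s z≤n))
    (ℕₚ.+-monoʳ-≤ R (ℕₚ.*-monoˡ-≤ R (counter≤D c))))

  -- the sink has rank at most m, so m steps suffice to reach it from the source
  rank-sink≤m : rank sink ≤ m
  rank-sink≤m = s≤s (ℕₚ.≤-trans (ℕₚ.≤-reflexive (count N D)) (ℕₚ.n≤1+n _))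
    where
    count : ∀ N D → suc D * suc (N * D) ≡ N * (D * suc D) + suc D
    count = solve-∀

  record Leaves (u : Fin m) (X : Vertex) (e : E) : Set where
    constructor leaves
    field
      starts : Edge.from e ≡ u
      climbs : rank X < rank (dec (Edge.to e))

  arc-leaves : ∀ {u} X Y {w o} → rank X < rank Y → Leaves u X (arc u Y w o)
  arc-leaves X Y X<Y = leaves refl (≡.subst (λ Z → rank X < rank Z) (≡.sym (dec-enc Y)) X<Y)

  varEdges-leave : ∀ u g k c i n → All (Leaves u (node g k c)) (varEdges u c i n)
  varEdges-leave u g k c i zero with suc (toℕ c) <? suc D
  ... | yes c+1≤D = arc-leaves (node g k c) (ret _) (rank-node-ret {g} {c} k (Finₚ.toℕ-fromℕ< c+1≤D)) ∷ []
  ... | no  _     = []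
  varEdges-leave u g k c i (suc _) = []

  nodeEdges-leave : ∀ u g k c v → All (Leaves u (node g k c)) (nodeEdges u g k c v)
  nodeEdges-leave u g k c (isConst a _) = []
  nodeEdges-leave u g k c (isVar i _)   = varEdges-leave u g k c i (toℕ k)
  nodeEdges-leave u g k c (isSum i j g<i g<j _) =
    arc-leaves (node g k c) (node i k c) (rank-node-node c g<i)
    ∷ arc-leaves (node g k c) (node j k c) (rank-node-node c g<j) ∷ []
  nodeEdges-leave u g k c (isProduct i j g<i g<j _) =
    arc-leaves (node g k c) (node j k c) (rank-node-node c g<j)
    ∷ Allₚ.++⁺ (Allₚ.tabulate⁺ (λ a → arc-leaves (node g k c) (node i (Fin.inject a) c) (rank-node-node c g<i)))
               (arc-leaves (node g k c) (node i k c) (rank-node-node c g<i) ∷ [])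

  finishEdges-leave : ∀ u c → All (Leaves u (ret c)) (finishEdges u c)
  finishEdges-leave u c with toℕ c ℕ.≟ D
  ... | yes c≡D = arc-leaves (ret c) sink (rank-ret-sink {c} c≡D) ∷ []
  ... | no  _   = []

  out-leaves : ∀ u X → All (Leaves u X) (out u X)
  out-leaves u source       =
    Allₚ.++⁺ (Allₚ.tabulate⁺ (λ k → arc-leaves source (node Fin.zero k (initial k)) (s≤s z≤n)))
             (arc-leaves source sink (s≤s z≤n) ∷ [])
  out-leaves u sink         = []
  out-leaves u (node g k c) = nodeEdges-leave u g k c (gateView C g)
  out-leaves u (ret c)      =
    Allₚ.++⁺ (Allₚ.tabulate⁺ (λ y → arc-leaves (ret c) (node (taskGate y) (taskDegree y) c)
                                                (rank-ret-node {taskGate y} {c})))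
             (finishEdges-leave u c)

  open WalkSums F program hiding (E)

  outgoing-out : ∀ u → outgoing u ≡ out u (dec u)
  outgoing-out u = begin
    filter from≟u (List.concat (tabulate (λ v → out v (dec v))))
      ≡⟨ filter-concat from≟u (tabulate (λ v → out v (dec v))) ⟩
    List.concat (map (filter from≟u) (tabulate (λ v → out v (dec v))))
      ≡⟨ ≡.cong List.concat (Listₚ.map-tabulate (λ v → out v (dec v)) (filter from≟u)) ⟩
    List.concat (tabulate (λ v → filter from≟u (out v (dec v))))
      ≡⟨ concat-tabulate-single _ u others-empty ⟩
    filter from≟u (out u (dec u))
      ≡⟨ Listₚ.filter-all from≟u (All.map Leaves.starts (out-leaves u (dec u))) ⟩
    out u (dec u)
      ∎
    where
    open ≡.≡-Reasoning
    from≟u : (e : E) → Dec (Edge.from e ≡ u)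
    from≟u e = Edge.from e Fin.≟ u
    others-empty : ∀ v → v ≢ u → filter from≟u (out v (dec v)) ≡ []
    others-empty v v≢u = Listₚ.filter-none from≟u
      (All.map (λ l from≡u → v≢u (≡.trans (≡.sym (Leaves.starts l)) from≡u)) (out-leaves v (dec v)))

  acyclic : Acyclic F program
  acyclic = acyclic-by-rank (rank ∘ dec) (Allₚ.concat⁺ (Allₚ.tabulate⁺ λ u →
    All.map (λ { (leaves refl up) → up }) (out-leaves u (dec u))))

  open StackMachine F {K}
  open ≋-Reasoning

  [_] : ∀ {a} {A : Set a} → Dec A → Poly F
  [ yes _ ] = 1P
  [ no  _ ] = 0P

  -- weight still to be produced by the pending tasks w after c degrees:
  -- the product of their components, provided the degrees add up to D
  pending : ℕ → Stack → Poly F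
  pending c []      = [ c ℕ.≟ D ]
  pending c (y ∷ w) = component (suc (toℕ (taskDegree y))) (val (taskGate y))
                      ⊗ pending (c + suc (toℕ (taskDegree y))) w

  atSink : Stack → Poly F
  atSink []      = 1P
  atSink (_ ∷ _) = 0P

  -- The invariant: the accepted walks from X, started with the stack w,
  -- have total weight  value X w.
  value : Vertex → Stack → Poly F
  value source       w = truncate D output ⊗ atSink w
  value sink         w = atSink w
  value (node g k c) w = component (suc (toℕ k)) (val g) ⊗ pending (toℕ c + suc (toℕ k)) w
  value (ret c)      w = pending (toℕ c) w

  pending-task : ∀ c j r w → pending c (task j r ∷ w) ≡ component (suc (toℕ r)) (val j) ⊗ pending (c + suc (toℕ r)) w
  pending-task c j r w rewrite taskGate-task j r | taskDegree-task j r = refl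

  pending-overflow : ∀ c w → D < c → pending c w ≋ 0P
  pending-overflow c [] D<c with c ℕ.≟ D
  ... | yes refl = ⊥-elim (ℕₚ.<-irrefl refl D<c)
  ... | no  _    = ≃-refl
  pending-overflow c (y ∷ w) D<c =
    ≃-trans (⊗-congˡ _ (pending-overflow _ w (ℕₚ.<-≤-trans D<c (ℕₚ.m≤m+n c _)))) (⊗-zeroʳ _)

  pending-full : ∀ w → pending D w ≋ atSink w
  pending-full [] with D ℕ.≟ D
  ... | yes _  = ≃-refl
  ... | no D≢D = ⊥-elim (D≢D refl)
  pending-full (y ∷ w) = ≃-trans (⊗-congˡ _ (pending-overflow _ w (ℕₚ.m<m+n D (s≤s z≤n)))) (⊗-zeroʳ _)

  Above : ℕ → Vertex → Set (c ⊔ ℓ)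
  Above f X = ∀ Y → rank X < rank Y → ∀ w → walkSum f (enc Y) w ≋ value Y w

  sink-local : ∀ w → walkSum 0 (enc sink) w ≋ atSink w
  sink-local []      = ⊕-idʳ _
  sink-local (_ ∷ _) = ⊕-idʳ _

  source-local : ∀ f → Above f source → ∀ w →
                 Σᴸ (map (viaEdge f w) (sourceEdges (enc source))) ≋ value source w
  source-local f ih w = begin
    Σᴸ (map V (tabulate initial-arc ++ sink-arc ∷ []))
      ≈⟨ Σᴸ-map-tabulate-++ V initial-arc (sink-arc ∷ []) ⟩
    Σᴸ (tabulate (V ∘ initial-arc)) ⊕ (V sink-arc ⊕ 0P)
      ≈⟨ ⊕-cong (Σᴸ-tabulate D (V ∘ initial-arc) (λ a → component (suc a) output ⊗ atSink w) initial-value)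
                (≃-trans (⊕-idʳ _) sink-value) ⟩
    Σ< D (λ a → component (suc a) output ⊗ atSink w) ⊕ (component 0 output ⊗ atSink w)
      ≈⟨ ≃-trans (⊕-comm _ _) (⊕-congˡ _ (Σ<-⊗ʳ D (atSink w) (λ a → component (suc a) output))) ⟩
    (component 0 output ⊗ atSink w) ⊕ (Σ< D (λ a → component (suc a) output) ⊗ atSink w)
      ≈⟨ ≃-sym (distribʳ _ _ _) ⟩
    truncate D output ⊗ atSink w
      ∎
    where
    u : Fin m
    u = enc source
    V : E → Poly F
    V = viaEdge f w
    initial-arc : Fin D → E
    initial-arc k = arc u (node Fin.zero k (initial k)) one nop
    sink-arc : E
    sink-arc = arc u sink (wconst (constantTerm output)) nop
    initial-value : ∀ k → V (initial-arc k) ≋ component (suc (toℕ k)) output ⊗ atSink w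
    initial-value k = begin
      1P ⊗ walkSum f (enc (node Fin.zero k (initial k))) w
        ≈⟨ ⊗-idˡ _ ⟩
      walkSum f (enc (node Fin.zero k (initial k))) w
        ≈⟨ ih (node Fin.zero k (initial k)) (s≤s z≤n) w ⟩
      component (suc (toℕ k)) output ⊗ pending (toℕ (initial k) + suc (toℕ k)) w
        ≡⟨ ≡.cong (λ d → component (suc (toℕ k)) output ⊗ pending d w) initial+k+1≡D ⟩
      component (suc (toℕ k)) output ⊗ pending D w
        ≈⟨ ⊗-congˡ _ (pending-full w) ⟩
      component (suc (toℕ k)) output ⊗ atSink w
        ∎
      where
      initial+k+1≡D : toℕ (initial k) + suc (toℕ k) ≡ D
      initial+k+1≡D = ≡.trans (≡.cong (_+ suc (toℕ k)) (Finₚ.toℕ-fromℕ< _)) (ℕₚ.m∸n+n≡m (Finₚ.toℕ<n k))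
    sink-value : V sink-arc ≋ component 0 output ⊗ atSink w
    sink-value = ⊗-cong (≃-sym (component-zero output)) (ih sink (s≤s z≤n) w)

  ret-local : ∀ f c → Above f (ret c) → ∀ w → Σᴸ (map (viaEdge f w) (retEdges (enc (ret c)) c)) ≋ pending (toℕ c) w
  ret-local f c ih w = begin
    Σᴸ (map V (tabulate pop-arc ++ finishEdges u c))
      ≈⟨ Σᴸ-map-tabulate-++ V pop-arc (finishEdges u c) ⟩
    Σᴸ (tabulate (V ∘ pop-arc)) ⊕ Σᴸ (map V (finishEdges u c))
      ≈⟨ by-stack w ⟩
    pending (toℕ c) w
      ∎
    where
    u : Fin m
    u = enc (ret c)
    V : E → Poly F
    V = viaEdge f w
    pop-arc : Fin K → E
    pop-arc y = arc u (node (taskGate y) (taskDegree y) c) one (pop y)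
    -- popping the top symbol y₀ of the stack leads to its task; other pops fail
    by-stack : ∀ w → Σᴸ (tabulate (viaEdge f w ∘ pop-arc)) ⊕ Σᴸ (map (viaEdge f w) (finishEdges u c)) ≋ pending (toℕ c) w
    by-stack [] with toℕ c ℕ.≟ D
    ... | yes c≡D = ≃-trans (⊕-cong (Σᴸ-tabulate-zero K _ (λ _ → ≃-refl))
                                    (≃-trans (⊕-idʳ _) (⊗-congˡ 1P (ih sink (rank-ret-sink {c} c≡D) []))))
                            (≃-trans (⊕-idˡ _) (⊗-idʳ _))
    ... | no  _   = ≃-trans (⊕-idʳ _) (Σᴸ-tabulate-zero K _ (λ _ → ≃-refl))
    by-stack (y₀ ∷ w) = ≃-trans (⊕-cong pops finish) (⊕-idʳ _)
      where
      Y₀ : Vertex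
      Y₀ = node (taskGate y₀) (taskDegree y₀) c
      pops : Σᴸ (tabulate (viaEdge f (y₀ ∷ w) ∘ pop-arc)) ≋ pending (toℕ c) (y₀ ∷ w)
      pops = begin
        Σᴸ (tabulate (viaEdge f (y₀ ∷ w) ∘ pop-arc))
          ≈⟨ Σᴸ-tabulate-single K _ y₀ (λ y y≢y₀ →
               ≡⇒≋ (≡.cong (λ r → continue r 1P _) (apply-pop-other y y₀ w y≢y₀))) ⟩
        continue (apply (y₀ ∷ w) (pop y₀)) 1P (walkSum f (enc Y₀))
          ≡⟨ ≡.cong (λ r → continue r 1P (walkSum f (enc Y₀))) (apply-pop-top y₀ w) ⟩
        1P ⊗ walkSum f (enc Y₀) w
          ≈⟨ ≃-trans (⊗-idˡ _) (ih Y₀ (rank-ret-node {taskGate y₀} {c}) w) ⟩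
        pending (toℕ c) (y₀ ∷ w)
          ∎
      finish : Σᴸ (map (viaEdge f (y₀ ∷ w)) (finishEdges u c)) ≋ 0P
      finish with toℕ c ℕ.≟ D
      ... | yes c≡D = ≃-trans (⊕-idʳ _) (≃-trans (⊗-congˡ 1P (ih sink (rank-ret-sink {c} c≡D) (y₀ ∷ w))) (⊗-zeroʳ _))
      ... | no  _   = ≃-refl

  var-local : ∀ f g k c i → Above f (node g k c) → ∀ n w →
              Σᴸ (map (viaEdge f w) (varEdges (enc (node g k c)) c i n)) ≋ component (suc n) (var i) ⊗ pending (toℕ c + suc n) w
  var-local f g k c i ih zero w with suc (toℕ c) <? suc D
  ... | yes c+1≤D = ≃-trans (⊕-idʳ _) (⊗-congˡ (var i) (≃-trans
          (ih (ret c′) (rank-node-ret {g} {c} k (Finₚ.toℕ-fromℕ< c+1≤D)) w)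
          (≡⇒≋ (≡.cong (λ d → pending d w) (≡.trans (Finₚ.toℕ-fromℕ< c+1≤D) (ℕₚ.+-comm 1 (toℕ c)))))))
    where
    c′ : Fin (suc D)
    c′ = fromℕ< c+1≤D
  ... | no  c+1≰D = ≃-sym (≃-trans (⊗-congˡ (var i) (pending-overflow (toℕ c + 1) w
          (≡.subst (D <_) (ℕₚ.+-comm 1 (toℕ c)) (ℕₚ.≮⇒≥ c+1≰D)))) (⊗-zeroʳ _))
  var-local f g k c i ih (suc n) w = ≃-sym (⊗-zeroˡ _)

  middle-degrees : ∀ c {a k} → a < k → suc (k ∸ suc a) ≡ k ∸ a × c + suc a + (k ∸ a) ≡ c + suc k
  middle-degrees c {a} {k} a<k =
    ≡.sym (ℕₚ.+-∸-assoc 1 a<k) ,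
    ≡.trans (ℕₚ.+-assoc c (suc a) (k ∸ a)) (≡.cong (λ d → c + suc d) (ℕₚ.m+[n∸m]≡n (ℕₚ.<⇒≤ a<k)))

  middle-value : ∀ f g k c i j → Above f (node g k c) → toℕ g < toℕ i → ∀ w (a : Fin (toℕ k)) →
    viaEdge f w (arc (enc (node g k c)) (node i (Fin.inject a) c) one (push (task j (rest k a))))
    ≋ (component (suc (toℕ a)) (val i) ⊗ component (toℕ k ∸ toℕ a) (val j)) ⊗ pending (toℕ c + suc (toℕ k)) w
  middle-value f g k c i j ih g<i w a = begin
    1P ⊗ walkSum f (enc (node i (Fin.inject a) c)) (task j r ∷ w)
      ≈⟨ ≃-trans (⊗-idˡ _) (ih (node i (Fin.inject a) c) (rank-node-node c g<i) (task j r ∷ w)) ⟩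
    ci (suc (toℕ (Fin.inject a))) ⊗ pending (toℕ c + suc (toℕ (Fin.inject a))) (task j r ∷ w)
      ≡⟨ ≡.cong (λ b → ci (suc b) ⊗ pending (toℕ c + suc b) (task j r ∷ w)) (Finₚ.toℕ-inject a) ⟩
    ci (suc x) ⊗ pending (toℕ c + suc x) (task j r ∷ w)
      ≡⟨ ≡.cong (ci (suc x) ⊗_) (pending-task (toℕ c + suc x) j r w) ⟩
    ci (suc x) ⊗ (cj (suc (toℕ r)) ⊗ pending (toℕ c + suc x + suc (toℕ r)) w)
      ≡⟨ ≡.cong (λ d → ci (suc x) ⊗ (cj (suc d) ⊗ pending (toℕ c + suc x + suc d) w)) (Finₚ.toℕ-fromℕ< _) ⟩
    ci (suc x) ⊗ (cj (suc (k′ ∸ suc x)) ⊗ pending (toℕ c + suc x + suc (k′ ∸ suc x)) w)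
      ≡⟨ ≡.cong (λ d → ci (suc x) ⊗ (cj d ⊗ pending (toℕ c + suc x + d) w)) (proj₁ degrees) ⟩
    ci (suc x) ⊗ (cj (k′ ∸ x) ⊗ pending (toℕ c + suc x + (k′ ∸ x)) w)
      ≡⟨ ≡.cong (λ d → ci (suc x) ⊗ (cj (k′ ∸ x) ⊗ pending d w)) (proj₂ degrees) ⟩
    ci (suc x) ⊗ (cj (k′ ∸ x) ⊗ pending (toℕ c + suc k′) w)
      ≈⟨ ≃-sym (⊗-assoc _ _ _) ⟩
    (ci (suc x) ⊗ cj (k′ ∸ x)) ⊗ pending (toℕ c + suc k′) w
      ∎
    where
    ci cj : ℕ → Poly F
    ci a = component a (val i)
    cj a = component a (val j)
    k′ x : ℕ
    k′ = toℕ k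
    x = toℕ a
    r : Fin D
    r = rest k a
    degrees : suc (k′ ∸ suc x) ≡ k′ ∸ x × toℕ c + suc x + (k′ ∸ x) ≡ toℕ c + suc k′
    degrees = middle-degrees (toℕ c) (Finₚ.toℕ<n a)

  product-local : ∀ f g k c i j → Above f (node g k c) → toℕ g < toℕ i → toℕ g < toℕ j → ∀ w →
                  Σᴸ (map (viaEdge f w) (productEdges (enc (node g k c)) i j k c))
                  ≋ component (suc (toℕ k)) (val i ⊗ val j) ⊗ pending (toℕ c + suc (toℕ k)) w
  product-local f g k c i j ih g<i g<j w = begin
    V first ⊕ Σᴸ (map V (tabulate middle ++ last ∷ []))
      ≈⟨ ⊕-congˡ _ (Σᴸ-map-tabulate-++ V middle (last ∷ [])) ⟩
    V first ⊕ (Σᴸ (tabulate (V ∘ middle)) ⊕ (V last ⊕ 0P))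
      ≈⟨ ⊕-cong first-value (⊕-cong middle-sum (≃-trans (⊕-idʳ _) last-value)) ⟩
    ((ci 0 ⊗ cj (suc k′)) ⊗ P) ⊕ ((Σ< k′ t ⊗ P) ⊕ ((ci (suc k′) ⊗ cj 0) ⊗ P))
      ≈⟨ ≃-trans (⊕-congˡ _ (≃-sym (distribʳ _ _ _))) (≃-sym (distribʳ _ _ _)) ⟩
    ((ci 0 ⊗ cj (suc k′)) ⊕ (Σ< k′ t ⊕ (ci (suc k′) ⊗ cj 0))) ⊗ P
      ≈⟨ ⊗-congʳ P (≃-sym (conv-extremes ci cj k′)) ⟩
    conv ci cj (suc k′) ⊗ P
      ∎
    where
    u : Fin m
    u = enc (node g k c)
    V : E → Poly F
    V = viaEdge f w
    k′ : ℕ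
    k′ = toℕ k
    P : Poly F
    P = pending (toℕ c + suc k′) w
    ci cj t : ℕ → Poly F
    ci a = component a (val i)
    cj a = component a (val j)
    t a = ci (suc a) ⊗ cj (k′ ∸ a)
    first last : E
    first = arc u (node j k c) (wconst (constantTerm (val i))) nop
    last  = arc u (node i k c) (wconst (constantTerm (val j))) nop
    middle : Fin k′ → E
    middle a = arc u (node i (Fin.inject a) c) one (push (task j (rest k a)))
    first-value : V first ≋ (ci 0 ⊗ cj (suc k′)) ⊗ P
    first-value = ≃-trans (⊗-cong (≃-sym (component-zero (val i))) (ih (node j k c) (rank-node-node c g<j) w))
                          (≃-sym (⊗-assoc _ _ _))
    last-value : V last ≋ (ci (suc k′) ⊗ cj 0) ⊗ P
    last-value = ≃-trans (⊗-cong (≃-sym (component-zero (val j))) (ih (node i k c) (rank-node-node c g<i) w))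
                         (≃-trans (≃-sym (⊗-assoc _ _ _)) (⊗-congʳ P (⊗-comm _ _)))
    middle-sum : Σᴸ (tabulate (V ∘ middle)) ≋ Σ< k′ t ⊗ P
    middle-sum = ≃-trans (Σᴸ-tabulate k′ (V ∘ middle) (λ a → t a ⊗ P) (middle-value f g k c i j ih g<i w))
                         (Σ<-⊗ʳ k′ P t)

  node-local : ∀ f g k c → Above f (node g k c) → (v : GateView C g) → ∀ w →
               Σᴸ (map (viaEdge f w) (nodeEdges (enc (node g k c)) g k c v)) ≋ value (node g k c) w
  node-local f g k c ih (isConst a val≡) w =
    ≃-sym (≃-trans (⊗-congʳ _ (component-resp (≡⇒≋ val≡) (suc (toℕ k)))) (⊗-zeroˡ _))
  node-local f g k c ih (isVar i val≡) w =
    ≃-trans (var-local f g k c i ih (toℕ k) w) (⊗-congʳ _ (component-resp (≡⇒≋ (≡.sym val≡)) (suc (toℕ k))))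
  node-local f g k c ih (isSum i j g<i g<j val≡) w = begin
    (1P ⊗ walkSum f (enc (node i k c)) w) ⊕ ((1P ⊗ walkSum f (enc (node j k c)) w) ⊕ 0P)
      ≈⟨ ⊕-cong (≃-trans (⊗-idˡ _) (ih (node i k c) (rank-node-node c g<i) w))
                (≃-trans (⊕-idʳ _) (≃-trans (⊗-idˡ _) (ih (node j k c) (rank-node-node c g<j) w))) ⟩
    (component d (val i) ⊗ P) ⊕ (component d (val j) ⊗ P)
      ≈⟨ ≃-sym (distribʳ _ _ _) ⟩
    component d (val i ⊕ val j) ⊗ P
      ≈⟨ ⊗-congʳ P (component-resp (≡⇒≋ (≡.sym val≡)) d) ⟩
    component d (val g) ⊗ P
      ∎
    where
    d : ℕ
    d = suc (toℕ k)
    P : Poly F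
    P = pending (toℕ c + d) w
  node-local f g k c ih (isProduct i j g<i g<j val≡) w =
    ≃-trans (product-local f g k c i j ih g<i g<j w) (⊗-congʳ _ (component-resp (≡⇒≋ (≡.sym val≡)) (suc (toℕ k))))

  local : ∀ f X → Above f X → ∀ w → walkSum 0 (enc X) w ⊕ Σᴸ (map (viaEdge f w) (out (enc X) X)) ≋ value X w
  local f source       ih w = ≃-trans (⊕-idˡ _) (source-local f ih w)
  local f sink         ih w = ≃-trans (⊕-idʳ _) (sink-local w)
  local f (node g k c) ih w = ≃-trans (⊕-idˡ _) (node-local f g k c ih (gateView C g) w)
  local f (ret c)      ih w = ≃-trans (⊕-idˡ _) (ret-local f c ih w)

  correct : ∀ f X → rank sink ≤ f + rank X → ∀ w → walkSum f (enc X) w ≋ value X w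
  correct zero sink _ w = sink-local w
  correct zero X@source       sink≤X _ = ⊥-elim (ℕₚ.<⇒≱ (rank<sink X (λ ())) sink≤X)
  correct zero X@(node _ _ _) sink≤X _ = ⊥-elim (ℕₚ.<⇒≱ (rank<sink X (λ ())) sink≤X)
  correct zero X@(ret _)      sink≤X _ = ⊥-elim (ℕₚ.<⇒≱ (rank<sink X (λ ())) sink≤X)
  correct (suc f) X sink≤ w = begin
    walkSum (suc f) (enc X) w
      ≈⟨ walkSum-suc f (enc X) w ⟩
    walkSum 0 (enc X) w ⊕ Σᴸ (map (viaEdge f w) (outgoing (enc X)))
      ≡⟨ ≡.cong (λ es → walkSum 0 (enc X) w ⊕ Σᴸ (map (viaEdge f w) es))
                (≡.trans (outgoing-out (enc X)) (≡.cong (out (enc X)) (dec-enc X))) ⟩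
    walkSum 0 (enc X) w ⊕ Σᴸ (map (viaEdge f w) (out (enc X) X))
      ≈⟨ local f X above w ⟩
    value X w
      ∎
    where
    above : Above f X
    above Y X<Y = correct f Y
      (ℕₚ.≤-trans sink≤ (≡.subst (_≤ f + rank Y) (ℕₚ.+-suc f (rank X)) (ℕₚ.+-monoʳ-≤ f X<Y)))

  computes : ∀ {p} → truncate D output ≋ p → SBPComputes F program p
  computes truncation≋p = walkSum⇒computes (begin
    walkSum m (enc source) []    ≈⟨ correct m source (ℕₚ.≤-trans rank-sink≤m (ℕₚ.m≤m+n m 0)) [] ⟩
    truncate D output ⊗ 1P       ≈⟨ ⊗-idʳ _ ⟩
    truncate D output            ≈⟨ truncation≋p ⟩
    _                            ∎)

-- The program for a circuit with at most X = bound a n gates and degree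
-- bound X has O(X³) vertices, which is at most bound (sizeExponent a) n.
module SizeBound where
  open ℕₚ.≤-Reasoning

  cube : ℕ → ℕ
  cube x = x * x * x

  x²≤cube+1 : ∀ x → x * x ≤ cube x + 1
  x²≤cube+1 zero    = z≤n
  x²≤cube+1 (suc y) = ℕₚ.≤-trans (ℕₚ.m≤m*n (suc y * suc y) (suc y)) (ℕₚ.m≤m+n _ 1)

  x≤cube+1 : ∀ x → x ≤ cube x + 1
  x≤cube+1 zero    = z≤n
  x≤cube+1 (suc y) = ℕₚ.≤-trans (ℕₚ.m≤m*n (suc y) (suc y)) (x²≤cube+1 (suc y))

  cube-suc : ∀ x → cube (x + 1) ≤ 8 * (cube x + 1)
  cube-suc x = begin
    cube (x + 1)
      ≡⟨ expand x ⟩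
    cube x + 3 * (x * x) + 3 * x + 1
      ≤⟨ ℕₚ.+-monoˡ-≤ 1 (ℕₚ.+-mono-≤ (ℕₚ.+-monoʳ-≤ (cube x) (ℕₚ.*-monoʳ-≤ 3 (x²≤cube+1 x)))
                                    (ℕₚ.*-monoʳ-≤ 3 (x≤cube+1 x))) ⟩
    cube x + 3 * (cube x + 1) + 3 * (cube x + 1) + 1
      ≡⟨ collect (cube x) ⟩
    7 * (cube x + 1)
      ≤⟨ ℕₚ.*-monoˡ-≤ (cube x + 1) (ℕₚ.n≤1+n 7) ⟩
    8 * (cube x + 1)
      ∎
    where
    expand : ∀ x → (x + 1) * (x + 1) * (x + 1) ≡ x * x * x + 3 * (x * x) + 3 * x + 1
    expand = solve-∀
    collect : ∀ c → c + 3 * (c + 1) + 3 * (c + 1) + 1 ≡ 7 * (c + 1)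
    collect = solve-∀

  -- n ^ a is monotone in a, up to the case n = 0 where 0 ^ 0 = 1
  pow-mono : ∀ n {a b} → a ≤ b → n ^ a ≤ n ^ b + 1
  pow-mono zero    {zero}  _   = ℕₚ.m≤n+m 1 _
  pow-mono zero    {suc a} _   = z≤n
  pow-mono (suc n)         a≤b = ℕₚ.≤-trans (ℕₚ.^-monoʳ-≤ (suc n) a≤b) (ℕₚ.m≤m+n _ 1)

  -- a circuit with at most X gates and degree bound X gives a program with
  -- 2 + s·X·(X+1) + X + 1 vertices
  program-size : ∀ s X → suc s ≤ X → 2 + (suc s * (X * suc X) + suc X) ≤ 5 * (cube X + 1)
  program-size s X s<X = begin
    2 + (suc s * (X * suc X) + suc X)
      ≤⟨ ℕₚ.+-monoʳ-≤ 2 (ℕₚ.+-monoˡ-≤ (suc X) (ℕₚ.*-monoˡ-≤ (X * suc X) s<X)) ⟩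
    2 + (X * (X * suc X) + suc X)
      ≡⟨ expand X ⟩
    3 + X + X * X + cube X
      ≤⟨ ℕₚ.+-monoˡ-≤ (cube X) (ℕₚ.+-mono-≤ (ℕₚ.+-monoʳ-≤ 3 (x≤cube+1 X)) (x²≤cube+1 X)) ⟩
    3 + (cube X + 1) + (cube X + 1) + cube X
      ≡⟨ collect (cube X) ⟩
    3 * (cube X + 1) + 2
      ≤⟨ ℕₚ.+-monoʳ-≤ (3 * (cube X + 1)) (ℕₚ.*-monoʳ-≤ 2 (ℕₚ.m≤n+m 1 (cube X))) ⟩
    3 * (cube X + 1) + 2 * (cube X + 1)
      ≡⟨ ≡.sym (ℕₚ.*-distribʳ-+ (cube X + 1) 3 2) ⟩
    5 * (cube X + 1)
      ∎
    where
    expand : ∀ X → 2 + (X * (X * suc X) + suc X) ≡ 3 + X + X * X + X * X * X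
    expand = solve-∀
    collect : ∀ c → 3 + (c + 1) + (c + 1) + c ≡ 3 * (c + 1) + 2
    collect = solve-∀

  -- bound a n = a · (nᵃ + 1)
  bound-cube : ∀ a n → cube (bound a n) + 1 ≤ (cube a + 1) * cube (n ^ a + 1)
  bound-cube a n = begin
    cube (bound a n) + 1                ≡⟨ ≡.cong (_+ 1) (factor a (n ^ a)) ⟩
    cube a * cube (n ^ a + 1) + 1       ≤⟨ ℕₚ.+-monoʳ-≤ (cube a * cube (n ^ a + 1)) (1≤cube-suc (n ^ a)) ⟩
    cube a * cube (n ^ a + 1) + cube (n ^ a + 1) ≡⟨ collect (cube a) (cube (n ^ a + 1)) ⟩
    (cube a + 1) * cube (n ^ a + 1)     ∎
    where
    factor : ∀ a p → (a * p + a) * (a * p + a) * (a * p + a) ≡ a * a * a * ((p + 1) * (p + 1) * (p + 1))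
    factor = solve-∀
    collect : ∀ A P → A * P + P ≡ (A + 1) * P
    collect = solve-∀
    1≤cube-suc : ∀ p → 1 ≤ cube (p + 1)
    1≤cube-suc p = ℕₚ.*-mono-≤ (ℕₚ.*-mono-≤ (ℕₚ.m≤n+m 1 p) (ℕₚ.m≤n+m 1 p)) (ℕₚ.m≤n+m 1 p)

  power-cube : ∀ n a b → a + a + a ≤ b → cube (n ^ a + 1) ≤ 16 * (n ^ b + 1)
  power-cube n a b 3a≤b = begin
    cube (n ^ a + 1)                 ≤⟨ cube-suc (n ^ a) ⟩
    8 * (cube (n ^ a) + 1)           ≡⟨ ≡.cong (λ x → 8 * (x + 1)) cube-pow ⟩
    8 * (n ^ (a + a + a) + 1)        ≤⟨ ℕₚ.*-monoʳ-≤ 8 (ℕₚ.+-monoˡ-≤ 1 (pow-mono n 3a≤b)) ⟩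
    8 * (n ^ b + 1 + 1)              ≤⟨ ℕₚ.*-monoʳ-≤ 8 (ℕₚ.+-monoʳ-≤ (n ^ b + 1) (ℕₚ.m≤n+m 1 (n ^ b))) ⟩
    8 * (n ^ b + 1 + (n ^ b + 1))    ≡⟨ double (n ^ b + 1) ⟩
    16 * (n ^ b + 1)                 ∎
    where
    cube-pow : cube (n ^ a) ≡ n ^ (a + a + a)
    cube-pow = ≡.sym (≡.trans (ℕₚ.^-distribˡ-+-* n (a + a) a) (≡.cong (_* n ^ a) (ℕₚ.^-distribˡ-+-* n a a)))
    double : ∀ y → 8 * (y + y) ≡ 16 * y
    double = solve-∀

  sizeExponent : ℕ → ℕ
  sizeExponent a = a + a + a + 80 * (cube a + 1)

  size-bound : ∀ a n s → suc s ≤ bound a n →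
    2 + (suc s * (bound a n * suc (bound a n)) + suc (bound a n)) ≤ bound (sizeExponent a) n
  size-bound a n s s<X = begin
    2 + (suc s * (X * suc X) + suc X)         ≤⟨ program-size s X s<X ⟩
    5 * (cube X + 1)                          ≤⟨ ℕₚ.*-monoʳ-≤ 5 (bound-cube a n) ⟩
    5 * ((cube a + 1) * cube (n ^ a + 1))     ≤⟨ ℕₚ.*-monoʳ-≤ 5 (ℕₚ.*-monoʳ-≤ (cube a + 1) power-bound) ⟩
    5 * ((cube a + 1) * (16 * (n ^ b + 1)))   ≡⟨ collect (cube a + 1) (n ^ b + 1) ⟩
    80 * (cube a + 1) * (n ^ b + 1)           ≤⟨ ℕₚ.*-monoˡ-≤ (n ^ b + 1) (ℕₚ.m≤n+m _ (a + a + a)) ⟩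
    b * (n ^ b + 1)                           ≡⟨ ℕₚ.*-distribˡ-+ b (n ^ b) 1 ⟩
    b * n ^ b + b * 1                         ≡⟨ ≡.cong (b * n ^ b +_) (ℕₚ.*-identityʳ b) ⟩
    bound b n                                 ∎
    where
    X b : ℕ
    X = bound a n
    b = sizeExponent a
    power-bound : cube (n ^ a + 1) ≤ 16 * (n ^ b + 1)
    power-bound = power-cube n a b (ℕₚ.m≤m+n (a + a + a) _)
    collect : ∀ A y → 5 * (A * (16 * y)) ≡ 80 * A * y
    collect = solve-∀


open SizeBound using (sizeExponent; size-bound)

lemma13 : ∀ {c ℓ : Level} (F : Field c ℓ) (f : ℕ → Poly F) →
    InVP F f →
    Σ[ b ∈ ℕ ] (∀ n → Σ[ B ∈ SBP F ]
    (Acyclic F B × sbpSize F B ≤ bound b n × SBPComputes F B (f n)))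
lemma13 F f (a , inVP) = sizeExponent a , λ n → programFor n (inVP n)
  where
  open PolyAlgebra F
  programFor : ∀ n → DegreeAtMost F (f n) (bound a n) × Σ[ s ∈ ℕ ] (suc s ≤ bound a n ×
                 Σ[ C ∈ Circuit F (suc s) ] CircuitComputes F C (f n)) →
               Σ[ B ∈ SBP F ] (Acyclic F B × sbpSize F B ≤ bound (sizeExponent a) n × SBPComputes F B (f n))
  programFor n (deg , s , s<X , C , C-computes) =
    program , acyclic , size-bound a n s s<X ,
    computes (≃-trans (truncate-resp (bound a n) C-computes) (truncate-DegreeAtMost deg))
    where open Construction F C (bound a n)
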